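{- Let $\mathcal{M}$ be a matroid with matroid polytope $P_{\mathcal{M}}$, let $v\in\mathrm{Dr}_{\mathcal{M}}$ be a valuation on $\mathcal{M}$, let $L$ be the lineality space of the Dressian $\mathrm{Dr}_{\mathcal{M}}$, and let $\Delta_v$ be the matroid subdivision of $P_{\mathcal{M}}$ induced by $v$. Then $$\Delta_v=\{P_{\mathcal{M}_w} : w\in v+L\}.$$
   Context: Let $\mathcal{M}$ be a matroid of rank $d$ on $[n]$ with set of bases $\mathcal{B}$. The Dressian $\mathrm{Dr}_{\mathcal{M}}\subset\mathbb{R}^{\mathcal{B}}$ is the set of $v\in\mathbb{R}^{\mathcal{B}}$ such that, extending $v$ by $v_\sigma=\infty$ for $d$-subsets $\sigma\notin\mathcal{B}$, for every $S\in\binom{[n]}{d-2}$ and distinct $i,j,k,l\in[n]\setminus S$ the minimum of $v_{Sij}+v_{Skl}$, $v_{Sik}+v_{Sjl}$, $v_{Sil}+v_{Sjk}$ is attained at least twice (or is $\infty$), where $Sij=S\cup\{i,j\}$. The points of $\mathrm{Dr}_{\mathcal{M}}$ are the valuations on $\mathcal{M}$. The lineality space of $\mathrm{Dr}_{\mathcal{M}}$ is the largest linear subspace $L\subset\mathbb{R}^{\mathcal{B}}$ such that $w+u\in\mathrm{Dr}_{\mathcal{M}}$ for all $w\in\mathrm{Dr}_{\mathcal{M}}$, $u\in L$. For $w\in\mathrm{Dr}_{\mathcal{M}}$, the initial matroid $\mathcal{M}_w$ is the matroid with bases $\{\sigma\in\mathcal{B}: w_\sigma\text{ is minimal}\}$.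 The matroid polytope is $P_{\mathcal{M}}=\mathrm{conv}\{e_\sigma:\sigma\in\mathcal{B}\}$, $e_\sigma=\sum_{i\in\sigma}e_i\in\mathbb{R}^n$. $\Delta_v$ is the regular subdivision of $P_{\mathcal{M}}$ induced by $v$, regarded as the set of all its nonempty cells of all dimensions: the cells are the projections to $\mathbb{R}^n$ of the nonempty lower faces of $\mathrm{conv}\{(e_\sigma,v_\sigma):\sigma\in\mathcal{B}\}\subset\mathbb{R}^{n+1}$, i.e. the faces on which a linear functional with last coordinate positive is minimized. It is a known fact that $\Delta_v$ is a matroid subdivision (all cells are matroid polytopes) if and only if $v\in\mathrm{Dr}_{\mathcal{M}}$. -}

module Defs where

open import Level using (0ℓ; suc)
open import Algebra.Bundles using (CommutativeRing)
open import Data.Bool.Base using (if_then_else_)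
open import Data.Fin.Base using (Fin)
open import Data.Fin.Subset using (Subset; _∈_; _∉_; _∪_; _-_; ⁅_⁆; ∣_∣)
open import Data.Nat.Base as ℕ using (ℕ)
open import Data.Product.Base using (Σ-syntax; ∃-syntax; _×_)
open import Data.Sum.Base using (_⊎_)
open import Data.Vec.Base using (lookup)
open import Data.Vec.Functional using (Vector; init; last)
open import Function.Bundles using (_⇔_)
open import Relation.Binary.Core using (Rel)
open import Relation.Binary.Structures using (IsDecTotalOrder)
open import Relation.Binary.PropositionalEquality.Core using (_≡_; _≢_)
open import Relation.Nullary.Decidable.Core using (yes; no)
open import Relation.Nullary.Negation.Core using (¬_)
open import Relation.Nullary.Construct.Add.Supremum using (_⁺; ⊤⁺; [_])
open import Relation.Unary using (Pred; Decidable; Satisfiable; _≐_; _⊆_)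
import Algebra.Properties.Monoid.Sum as MonoidSum
import Data.Vec.Functional.Relation.Binary.Equality.Setoid as VectorEquality
import Relation.Binary.Construct.Add.Supremum.Equality as SupEquality
import Relation.Binary.Construct.Add.Supremum.NonStrict as SupOrder
import Relation.Binary.Construct.NonStrictToStrict as ToStrict

-- The real numbers, axiomatised as a Dedekind-complete ordered field.  The
-- order is that of the classical reals, hence total and decidable; under
-- excluded middle the Cauchy reals are a model, and any two models are
-- isomorphic.
record RealField : Set (suc 0ℓ) where
  infix 4 _≤_
  field
    commutativeRing : CommutativeRing 0ℓ 0ℓ

  open CommutativeRing commutativeRing public

  field
    _≤_             : Rel Carrier 0ℓ
    isDecTotalOrder : IsDecTotalOrder _≈_ _≤_
    0≉1             : ¬ (0# ≈ 1#)
    inverse         : ∀ x → ¬ (x ≈ 0#) → ∃[ y ] x * y ≈ 1#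
    +-monoˡ-≤       : ∀ {x y} z → x ≤ y → x + z ≤ y + z
    *-nonNeg        : ∀ {x y} → 0# ≤ x → 0# ≤ y → 0# ≤ x * y

  UpperBound : Pred Carrier 0ℓ → Pred Carrier 0ℓ
  UpperBound A b = ∀ x → A x → x ≤ b

  field
    complete : ∀ (A : Pred Carrier 0ℓ) → Satisfiable A → Satisfiable (UpperBound A) →
               ∃[ s ] UpperBound A s × (∀ b → UpperBound A b → s ≤ b)

  open ToStrict _≈_ _≤_ public using (_<_)
  open MonoidSum +-monoid public using (sum)
  open VectorEquality setoid public using (_≋_)

record Matroid (n d : ℕ) : Set (suc 0ℓ) where
  field
    Basis    : Pred (Subset n) 0ℓ
    Basis?   : Decidable Basis
    nonempty : Satisfiable Basis
    rank     : ∀ {σ} → Basis σ → ∣ σ ∣ ≡ d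
    exchange : ∀ {σ τ} → Basis σ → Basis τ → ∀ {i} → i ∈ σ → i ∉ τ →
               ∃[ j ] j ∈ τ × j ∉ σ × Basis ((σ - i) ∪ ⁅ j ⁆)

module Valuations (ℝ : RealField) where
  open RealField ℝ
  open SupEquality _≈_ using (_≈⁺_)
  open SupOrder _≤_ using (_≤⁺_)

  -- Coordinates are indexed by bases; the irrelevant argument makes them
  -- independent of the evidence that σ is a basis.
  ℝ^ : ∀ {n d} → Matroid n d → Set
  ℝ^ M = ∀ σ → .(Matroid.Basis M σ) → Carrier

  infixl 6 _+⁺_

  _+⁺_ : Carrier ⁺ → Carrier ⁺ → Carrier ⁺
  [ x ] +⁺ [ y ] = [ x + y ]
  [ _ ] +⁺ ⊤⁺    = ⊤⁺
  ⊤⁺    +⁺ _     = ⊤⁺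

  -- If the minimum is ∞ then all three arguments are ∞, and the condition
  -- holds because ∞ ≈⁺ ∞ and ∞ ≤⁺ ∞.
  MinAttainedTwice : Carrier ⁺ → Carrier ⁺ → Carrier ⁺ → Set
  MinAttainedTwice a b c =
    (a ≈⁺ b × a ≤⁺ c) ⊎ (a ≈⁺ c × a ≤⁺ b) ⊎ (b ≈⁺ c × b ≤⁺ a)

  module _ {n d : ℕ} (M : Matroid n d) where
    open Matroid M

    infixl 7 _*ᵛ_
    infixl 6 _+ᵛ_
    infix  4 _≈ᵛ_

    extend : ℝ^ M → Subset n → Carrier ⁺
    extend v σ with Basis? σ
    ... | yes b = [ v σ b ]
    ... | no  _ = ⊤⁺

    Dressian : Pred (ℝ^ M) 0ℓ
    Dressian v =
      ∀ (S : Subset n) → 2 ℕ.+ ∣ S ∣ ≡ d →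
      ∀ i j k l → i ∉ S → j ∉ S → k ∉ S → l ∉ S →
      i ≢ j → i ≢ k → i ≢ l → j ≢ k → j ≢ l → k ≢ l →
      let v[_,_] = λ a b → extend v (S ∪ (⁅ a ⁆ ∪ ⁅ b ⁆)) in
      MinAttainedTwice (v[ i , j ] +⁺ v[ k , l ])
                       (v[ i , k ] +⁺ v[ j , l ])
                       (v[ i , l ] +⁺ v[ j , k ])

    _≈ᵛ_ : Rel (ℝ^ M) 0ℓ
    u ≈ᵛ w = ∀ σ (b : Basis σ) → u σ b ≈ w σ b

    _+ᵛ_ : ℝ^ M → ℝ^ M → ℝ^ M
    (u +ᵛ w) σ b = u σ b + w σ b

    _*ᵛ_ : Carrier → ℝ^ M → ℝ^ M
    (c *ᵛ u) σ b = c * u σ b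

    record IsSubspace (L : Pred (ℝ^ M) 0ℓ) : Set where
      field
        resp     : ∀ {u w} → u ≈ᵛ w → L u → L w
        0-closed : L (λ _ _ → 0#)
        +-closed : ∀ {u w} → L u → L w → L (u +ᵛ w)
        *-closed : ∀ c {u} → L u → L (c *ᵛ u)

    TranslatesDressian : Pred (ℝ^ M) 0ℓ → Set
    TranslatesDressian L = ∀ w u → Dressian w → L u → Dressian (w +ᵛ u)

    record IsLinealitySpace (L : Pred (ℝ^ M) 0ℓ) : Set (suc 0ℓ) where
      field
        isSubspace : IsSubspace L
        translates : TranslatesDressian L
        largest    : ∀ L′ → IsSubspace L′ → TranslatesDressian L′ → L′ ⊆ L

    translate : ℝ^ M → Pred (ℝ^ M) 0ℓ → Pred (ℝ^ M) 0ℓ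
    translate v L w = ∃[ u ] L u × w ≈ᵛ (v +ᵛ u)

    IsInitialMatroid : ℝ^ M → Matroid n d → Set
    IsInitialMatroid w N = ∀ σ →
      Matroid.Basis N σ ⇔ (Σ[ b ∈ Basis σ ] ∀ τ (b′ : Basis τ) → w σ b ≤ w τ b′)

  conv : ∀ {m} → Pred (Vector Carrier m) 0ℓ → Pred (Vector Carrier m) 0ℓ
  conv A x =
    ∃[ k ] Σ[ p ∈ (Fin k → Vector Carrier _) ] Σ[ c ∈ Vector Carrier k ]
      (∀ a → A (p a)) × (∀ a → 0# ≤ c a) × sum c ≈ 1# ×
      x ≋ (λ t → sum (λ a → c a * p a t))

  e : ∀ {n} → Subset n → Vector Carrier n
  e σ t = if lookup σ t then 1# else 0#

  ⟨_,_⟩ : ∀ {m} → Vector Carrier m → Vector Carrier m → Carrier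
  ⟨ c , x ⟩ = sum (λ t → c t * x t)

  face : ∀ {m} → Pred (Vector Carrier m) 0ℓ → Vector Carrier m → Pred (Vector Carrier m) 0ℓ
  face Q c y = Q y × (∀ z → Q z → ⟨ c , y ⟩ ≤ ⟨ c , z ⟩)

  project : ∀ {n} → Pred (Vector Carrier (ℕ.suc n)) 0ℓ → Pred (Vector Carrier n) 0ℓ
  project Q x = ∃[ y ] Q y × x ≋ init y

  module _ {n d : ℕ} (M : Matroid n d) where
    open Matroid M

    polytope : Pred (Vector Carrier n) 0ℓ
    polytope = conv (λ x → ∃[ σ ] Basis σ × x ≋ e σ)

    liftedPolytope : ℝ^ M → Pred (Vector Carrier (ℕ.suc n)) 0ℓ
    liftedPolytope v =
      conv (λ y → ∃[ σ ] Σ[ b ∈ Basis σ ] init y ≋ e σ × last y ≈ v σ b)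

    Subdivision : ℝ^ M → Pred (Pred (Vector Carrier n) 0ℓ) 0ℓ
    Subdivision v C = ∃[ c ]
      0# < last c ×
      Satisfiable (face (liftedPolytope v) c) ×
      C ≐ project (face (liftedPolytope v) c)

  -- {P_{M_w} : w ∈ W}.  That the minimal bases of w form a matroid N is part
  -- of membership rather than presupposed.
  InitialPolytopes : ∀ {n d} (M : Matroid n d) → Pred (ℝ^ M) 0ℓ →
                     Pred (Pred (Vector Carrier n) 0ℓ) (suc 0ℓ)
  InitialPolytopes {n} {d} M W C =
    ∃[ w ] W w × Σ[ N ∈ Matroid n d ] IsInitialMatroid M w N × C ≐ polytope N

{-# OPTIONS --safe #-}
module Submission where

open import Defs
open import Level using (0ℓ)
open import Algebra.Bundles using (CommutativeRing)
open import Data.Bool.Base using (Bool; true; false)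
open import Data.Bool.Properties using (∨-zeroʳ; ∨-identityʳ; ¬-not)
open import Data.Fin.Base using (Fin; zero; suc)
open import Data.Fin.Properties using (_≟_; any?)
open import Data.Fin.Subset using (Subset; _∈_; _∉_; _∪_; _∩_; _-_; ∁; _⊂_; ⁅_⁆; ∣_∣; inside; outside)
open import Data.Fin.Subset.Induction using (⊂-wellFounded; Acc; acc)
open import Data.Fin.Subset.Properties
  using (∪-assoc; ∪-identityʳ; p─⊥≡p; x∈p∩q⁺; x∈p∩q⁻; x∈∁p⇒x∉p; x∉p⇒x∈∁p)
open import Data.List.Base using (List; []; _∷_; filter; allFin; cartesianProduct; cartesianProductWith)
open import Data.List.Membership.Propositional.Properties
  using (∈-allFin; ∈-filter⁺; ∈-cartesianProduct⁺; ∈-cartesianProductWith⁺)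
open import Data.List.Relation.Unary.All as All using (All; []; _∷_)
open import Data.List.Relation.Unary.All.Properties using (all-filter)
open import Data.List.Relation.Unary.Any using (here; there)
open import Data.Nat.Base as ℕ using (ℕ)
open import Data.Product.Base using (Σ-syntax; ∃-syntax; _×_; _,_; proj₁; proj₂)
open import Data.Sum.Base as Sum using (_⊎_; inj₁; inj₂; [_,_]′)
open import Data.Vec.Base using (Vec; []; _∷_; lookup; _[_]≔_)
open import Data.Vec.Functional using (Vector; tail; init; last)
open import Data.Vec.Properties
  using ([]≔-idempotent; []≔-commutes; []≔-lookup; lookup∘update; lookup∘update′; []=⇒lookup; lookup⇒[]=)
open import Function.Base using (_∘_; flip; id)
open import Function.Bundles using (Equivalence; mk⇔)
open import Relation.Binary.Bundles using (TotalOrder)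
open import Relation.Binary.Construct.Closure.Equivalence as EqClosure using (EqClosure)
open import Relation.Binary.Construct.Closure.ReflexiveTransitive using (ε; _◅_; _◅◅_)
open import Relation.Binary.Construct.Closure.Symmetric using (fwd; bwd)
open import Relation.Binary.Core using (Rel)
open import Relation.Binary.PropositionalEquality as ≡ using (_≡_; _≢_; refl; cong; cong₂; subst)
open import Relation.Binary.Structures using (IsDecTotalOrder)
open import Relation.Nullary.Construct.Add.Supremum using (_⁺; [_])
open import Relation.Nullary.Decidable.Core using (Dec; yes; no; _×-dec_; ¬?)
open import Relation.Nullary.Negation.Core using (¬_; contradiction)
open import Relation.Unary using (Pred; Decidable; Satisfiable; _≐_; _⊆_)
import Algebra.Properties.Ring as RingProperties
import Algebra.Properties.Semiring.Sum as SemiringSum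
import Algebra.Solver.Ring.NaturalCoefficients.Default as Solver
import Data.Bool.Properties as Bool
import Data.List.Extrema as Extrema
import Data.List.Membership.Propositional as List
import Data.Nat.Properties as ℕ
import Relation.Binary.Construct.Add.Supremum.Equality as SupEquality
import Relation.Binary.Construct.Add.Supremum.NonStrict as SupOrder
import Relation.Binary.Properties.TotalOrder as TotalOrderProperties
import Relation.Binary.Reasoning.Setoid as SetoidReasoning

-- If w = v + u with u affine in the vectors e_σ, then minimising w over the
-- bases is the same as minimising over the lifted vertices (e_σ , v_σ) a linear
-- functional whose last coordinate is positive.  So everything rests on
-- identifying the lineality space with the functions affine in e_σ, and on the
-- minimal bases of a valuation forming a matroid.
--
-- Linear functions lie in L since the three terms of each Plücker relation
-- contain the same elements.  Conversely, for u ∈ L both u and - u are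
-- valuations, hence any two finite terms of a three-term relation of u agree.
-- Around a basis σ this makes the alternating sum of u(σ - i + j) - u(σ) vanish
-- along cycles of the exchange graph of σ: pivoting on an edge of a cycle
-- shortens it.  After subtraction of a linear potential u is therefore constant
-- on the neighbours of σ, and since a local minimum of a valuation is global,
-- applied to u and - u, it is constant.  Both this last fact and the matroid
-- property of minimal bases come from the exchange property of valuated
-- matroids, which Murota's argument deduces from the three-term relations.

private variable
  n : ℕ
  a b c x : Fin n
  σ : Subset n

-- Subsets as bit vectors: membership, exchanges, insertion of pairs.

infix 4 _∋_ _∌_

-- Equations between bits make non-membership positive information, unlike `_∉_`.
_∋_ _∌_ : Subset n → Fin n → Set
σ ∋ x = lookup σ x ≡ inside
σ ∌ x = lookup σ x ≡ outside

∋×∌⇒≢ : σ ∋ a → σ ∌ b → a ≢ b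
∋×∌⇒≢ σ∋a σ∌b refl with () ← ≡.trans (≡.sym σ∋a) σ∌b

∌⇒∉ : σ ∌ x → x ∉ σ
∌⇒∉ σ∌x x∈σ with () ← ≡.trans (≡.sym σ∌x) ([]=⇒lookup x∈σ)

∉⇒∌ : x ∉ σ → σ ∌ x
∉⇒∌ {σ = σ} x∉σ = ¬-not (x∉σ ∘ lookup⇒[]= _ σ)

lookup-injective : ∀ {A : Set} (xs ys : Vec A n) → (∀ i → lookup xs i ≡ lookup ys i) → xs ≡ ys
lookup-injective []       []       _  = refl
lookup-injective (x ∷ xs) (y ∷ ys) eq = cong₂ _∷_ (eq zero) (lookup-injective xs ys (eq ∘ suc))

[]≔-fixed : ∀ {s} → lookup σ x ≡ s → σ [ x ]≔ s ≡ σ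
[]≔-fixed {σ = σ} {x = x} refl = []≔-lookup σ x

infixl 6 _⟨_↦_⟩ _⟪_,_⟫

-- Vector updates replace `∪` and `-`, so that membership follows from the update lemmas;
-- `exchange-⟨↦⟩` and `∪-⟪⟫` translate between the two.
_⟨_↦_⟩ _⟪_,_⟫ : Subset n → Fin n → Fin n → Subset n
σ ⟨ a ↦ b ⟩ = σ [ a ]≔ outside [ b ]≔ inside
S ⟪ a , b ⟫ = S [ a ]≔ inside [ b ]≔ inside

∪-⁅⁆ : ∀ (σ : Subset n) x → σ ∪ ⁅ x ⁆ ≡ σ [ x ]≔ inside
∪-⁅⁆ (s ∷ σ) zero    = cong₂ _∷_ (∨-zeroʳ s) (∪-identityʳ σ)
∪-⁅⁆ (s ∷ σ) (suc x) = cong₂ _∷_ (∨-identityʳ s) (∪-⁅⁆ σ x)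

─-⁅⁆ : ∀ (σ : Subset n) x → σ - x ≡ σ [ x ]≔ outside
─-⁅⁆ (s ∷ σ) zero    = cong (outside ∷_) (p─⊥≡p σ)
─-⁅⁆ (s ∷ σ) (suc x) = cong (s ∷_) (─-⁅⁆ σ x)

exchange-⟨↦⟩ : ∀ (σ : Subset n) a b → (σ - a) ∪ ⁅ b ⁆ ≡ σ ⟨ a ↦ b ⟩
exchange-⟨↦⟩ σ a b = ≡.trans (∪-⁅⁆ (σ - a) b) (cong (_[ b ]≔ inside) (─-⁅⁆ σ a))

∪-⟪⟫ : ∀ (S : Subset n) a b → S ∪ (⁅ a ⁆ ∪ ⁅ b ⁆) ≡ S ⟪ a , b ⟫
∪-⟪⟫ S a b = ≡.trans (≡.sym (∪-assoc S ⁅ a ⁆ ⁅ b ⁆)) (≡.trans (∪-⁅⁆ (S ∪ ⁅ a ⁆) b) (cong (_[ b ]≔ inside) (∪-⁅⁆ S a)))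

∣[]≔inside∣ : ∀ (σ : Subset n) x → σ ∌ x → ∣ σ [ x ]≔ inside ∣ ≡ ℕ.suc ∣ σ ∣
∣[]≔inside∣ (outside ∷ σ) zero    _   = refl
∣[]≔inside∣ (inside  ∷ σ) (suc x) σ∌x = cong ℕ.suc (∣[]≔inside∣ σ x σ∌x)
∣[]≔inside∣ (outside ∷ σ) (suc x) σ∌x = ∣[]≔inside∣ σ x σ∌x

∣⟪⟫∣ : ∀ {S : Subset n} {a b} → S ∌ a → S ∌ b → a ≢ b → ∣ S ⟪ a , b ⟫ ∣ ≡ 2 ℕ.+ ∣ S ∣
∣⟪⟫∣ {S = S} {a} {b} S∌a S∌b a≢b = ≡.trans
  (∣[]≔inside∣ (S [ a ]≔ inside) b (≡.trans (lookup∘update′ (a≢b ∘ ≡.sym) S inside) S∌b))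
  (cong ℕ.suc (∣[]≔inside∣ S a S∌a))

⟪⟫-sym : ∀ (S : Subset n) a b → S ⟪ a , b ⟫ ≡ S ⟪ b , a ⟫
⟪⟫-sym S a b with a ≟ b
... | yes refl = refl
... | no  a≢b  = []≔-commutes S a b a≢b

∋-⟪⟫₁ : ∀ (S : Subset n) a b → S ⟪ a , b ⟫ ∋ a
∋-⟪⟫₁ S a b with a ≟ b
... | yes refl = lookup∘update a (S [ a ]≔ inside) inside
... | no  a≢b  = ≡.trans (lookup∘update′ a≢b (S [ a ]≔ inside) inside) (lookup∘update a S inside)

lookup-⟪⟫ : ∀ {S : Subset n} {a b x} → x ≢ a → x ≢ b → lookup (S ⟪ a , b ⟫) x ≡ lookup S x
lookup-⟪⟫ {S = S} x≢a x≢b = ≡.trans (lookup∘update′ x≢b (S [ _ ]≔ inside) inside) (lookup∘update′ x≢a S inside)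

∋-⟪⟫⁻ : ∀ (S : Subset n) a b → S ⟪ a , b ⟫ ∋ x → x ≡ a ⊎ x ≡ b ⊎ S ∋ x
∋-⟪⟫⁻ {x = x} S a b ∋x with x ≟ a | x ≟ b
... | yes x≡a | _       = inj₁ x≡a
... | no  _   | yes x≡b = inj₂ (inj₁ x≡b)
... | no  x≢a | no  x≢b = inj₂ (inj₂ (≡.trans (≡.sym (lookup-⟪⟫ {S = S} x≢a x≢b)) ∋x))

∋-⟨↦⟩ : ∀ (σ : Subset n) a b → σ ⟨ a ↦ b ⟩ ∋ b
∋-⟨↦⟩ σ a b = lookup∘update b (σ [ a ]≔ outside) inside

∌-⟨↦⟩ : ∀ (σ : Subset n) → a ≢ b → σ ⟨ a ↦ b ⟩ ∌ a
∌-⟨↦⟩ {a = a} σ a≢b = ≡.trans (lookup∘update′ a≢b (σ [ a ]≔ outside) inside) (lookup∘update a σ outside)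

lookup-⟨↦⟩ : ∀ (σ : Subset n) → x ≢ a → x ≢ b → lookup (σ ⟨ a ↦ b ⟩) x ≡ lookup σ x
lookup-⟨↦⟩ σ x≢a x≢b = ≡.trans (lookup∘update′ x≢b (σ [ _ ]≔ outside) inside) (lookup∘update′ x≢a σ outside)

⟪⟫-⟨↦⟩ : ∀ {S : Subset n} {a b c} → S ∌ a → a ≢ b → S ⟪ a , b ⟫ ⟨ a ↦ c ⟩ ≡ S ⟪ b , c ⟫
⟪⟫-⟨↦⟩ {S = S} {a} {b} {c} S∌a a≢b = cong (_[ c ]≔ inside) (begin
  S [ a ]≔ inside [ b ]≔ inside [ a ]≔ outside ≡⟨ []≔-commutes (S [ a ]≔ inside) b a (a≢b ∘ ≡.sym) ⟩
  S [ a ]≔ inside [ a ]≔ outside [ b ]≔ inside ≡⟨ cong (_[ b ]≔ inside) ([]≔-idempotent S a) ⟩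
  S [ a ]≔ outside [ b ]≔ inside               ≡⟨ cong (_[ b ]≔ inside) ([]≔-fixed {σ = S} S∌a) ⟩
  S [ b ]≔ inside                              ∎)
  where open ≡.≡-Reasoning

module _ (σ : Subset n) {a b : Fin n} (σ∋a : σ ∋ a) (σ∋b : σ ∋ b) (a≢b : a ≢ b) where
  private
    σ∖ab : Subset n
    σ∖ab = σ [ a ]≔ outside [ b ]≔ outside

  ∌-∖₁ : σ∖ab ∌ a
  ∌-∖₁ = ≡.trans (lookup∘update′ a≢b (σ [ a ]≔ outside) outside) (lookup∘update a σ outside)

  ∌-∖₂ : σ∖ab ∌ b
  ∌-∖₂ = lookup∘update b (σ [ a ]≔ outside) outside

  ∌-∖ : ∀ {c} → σ ∌ c → σ∖ab ∌ c
  ∌-∖ {c} σ∌c = ≡.trans (lookup∘update′ (∋×∌⇒≢ {σ = σ} σ∋b σ∌c ∘ ≡.sym) (σ [ a ]≔ outside) outside)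
                   (≡.trans (lookup∘update′ (∋×∌⇒≢ {σ = σ} σ∋a σ∌c ∘ ≡.sym) σ outside) σ∌c)

  ∖-⟪₂⟫ : ∀ c → σ∖ab ⟪ b , c ⟫ ≡ σ ⟨ a ↦ c ⟩
  ∖-⟪₂⟫ c = cong (_[ c ]≔ inside) (≡.trans ([]≔-idempotent (σ [ a ]≔ outside) b)
    ([]≔-fixed {σ = σ [ a ]≔ outside} (≡.trans (lookup∘update′ (a≢b ∘ ≡.sym) σ outside) σ∋b)))

  ∖-⟪₁₂⟫ : σ∖ab ⟪ a , b ⟫ ≡ σ
  ∖-⟪₁₂⟫ = ≡.trans (⟪⟫-sym σ∖ab a b) (≡.trans (∖-⟪₂⟫ a)
            (≡.trans ([]≔-idempotent σ a) ([]≔-fixed {σ = σ} σ∋a)))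

  ∖-⟪⟫ : ∀ {c e} → σ ∌ c → σ∖ab ⟪ c , e ⟫ ≡ σ ⟨ a ↦ c ⟩ ⟨ b ↦ e ⟩
  ∖-⟪⟫ {c} {e} σ∌c = cong (_[ e ]≔ inside)
    ([]≔-commutes (σ [ a ]≔ outside) b c (∋×∌⇒≢ {σ = σ} σ∋b σ∌c))

∖-⟪₁⟫ : ∀ (σ : Subset n) → σ ∋ a → σ ∋ b → a ≢ b → ∀ c →
       σ [ a ]≔ outside [ b ]≔ outside ⟪ a , c ⟫ ≡ σ ⟨ b ↦ c ⟩
∖-⟪₁⟫ {a = a} {b} σ σ∋a σ∋b a≢b c = ≡.trans (cong _⟪ a , c ⟫ ([]≔-commutes σ a b a≢b))
  (∖-⟪₂⟫ σ σ∋b σ∋a (a≢b ∘ ≡.sym) c)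

-- The index data of one three-term relation. The order of the four elements fixes the term that is
-- read first; the swaps below pass to the other terms.
record Quad {n} (S : Subset n) (a b c e : Fin n) : Set where
  constructor quad
  field
    ∌₁ : S ∌ a
    ∌₂ : S ∌ b
    ∌₃ : S ∌ c
    ∌₄ : S ∌ e
    ≢₁₂ : a ≢ b
    ≢₁₃ : a ≢ c
    ≢₁₄ : a ≢ e
    ≢₂₃ : b ≢ c
    ≢₂₄ : b ≢ e
    ≢₃₄ : c ≢ e

module _ {n} {S : Subset n} {a b c e : Fin n} (q : Quad S a b c e) where
  open Quad q

  swap₁₂ : Quad S b a c e
  swap₁₂ = quad ∌₂ ∌₁ ∌₃ ∌₄ (≢₁₂ ∘ ≡.sym) ≢₂₃ ≢₂₄ ≢₁₃ ≢₁₄ ≢₃₄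

  swap₂₃ : Quad S a c b e
  swap₂₃ = quad ∌₁ ∌₃ ∌₂ ∌₄ ≢₁₃ ≢₁₂ ≢₁₄ (≢₂₃ ∘ ≡.sym) ≢₃₄ ≢₂₄

  swap₃₄ : Quad S a b e c
  swap₃₄ = quad ∌₁ ∌₂ ∌₄ ∌₃ ≢₁₂ ≢₁₄ ≢₁₃ ≢₂₄ ≢₂₃ (≢₃₄ ∘ ≡.sym)

swap-pairs : ∀ {n} {S : Subset n} {a b c e} → Quad S a b c e → Quad S c e a b
swap-pairs q = swap₂₃ (swap₃₄ (swap₁₂ (swap₂₃ q)))

quad-∖ : ∀ {n} (σ : Subset n) {a b c e} → σ ∋ a → σ ∋ b → σ ∌ c → σ ∌ e → a ≢ b → c ≢ e →
         Quad (σ [ a ]≔ outside [ b ]≔ outside) a b c e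
quad-∖ σ σ∋a σ∋b σ∌c σ∌e a≢b c≢e = quad
  (∌-∖₁ σ σ∋a σ∋b a≢b) (∌-∖₂ σ σ∋a σ∋b a≢b)
  (∌-∖ σ σ∋a σ∋b a≢b σ∌c) (∌-∖ σ σ∋a σ∋b a≢b σ∌e) a≢b
  (∋×∌⇒≢ {σ = σ} σ∋a σ∌c) (∋×∌⇒≢ {σ = σ} σ∋a σ∌e)
  (∋×∌⇒≢ {σ = σ} σ∋b σ∌c) (∋×∌⇒≢ {σ = σ} σ∋b σ∌e) c≢e

∌⇒¬∋ : ∀ {n} {σ : Subset n} {x} → σ ∌ x → ¬ (σ ∋ x)
∌⇒¬∋ σ∌x σ∋x with () ← ≡.trans (≡.sym σ∌x) σ∋x

¬∋⇒∌ : ∀ {n} {σ : Subset n} {x} → ¬ (σ ∋ x) → σ ∌ x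
¬∋⇒∌ = ¬-not

infix 4 _∋?_ _∌?_

_∋?_ : ∀ {n} (σ : Subset n) x → Dec (σ ∋ x)
σ ∋? x = lookup σ x Bool.≟ inside

_∌?_ : ∀ {n} (σ : Subset n) x → Dec (σ ∌ x)
σ ∌? x = lookup σ x Bool.≟ outside

⟨↦⟩-inverse : ∀ {n} (σ : Subset n) {a b} → σ ∋ a → σ ∌ b → σ ⟨ a ↦ b ⟩ ⟨ b ↦ a ⟩ ≡ σ
⟨↦⟩-inverse σ {a} {b} σ∋a σ∌b = begin
  σ [ a ]≔ outside [ b ]≔ inside [ b ]≔ outside [ a ]≔ inside
    ≡⟨ cong (_[ a ]≔ inside) ([]≔-idempotent (σ [ a ]≔ outside) b) ⟩
  σ [ a ]≔ outside [ b ]≔ outside [ a ]≔ inside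
    ≡⟨ cong (_[ a ]≔ inside) ([]≔-fixed {σ = σ [ a ]≔ outside} (≡.trans (lookup∘update′ b≢a σ outside) σ∌b)) ⟩
  σ [ a ]≔ outside [ a ]≔ inside
    ≡⟨ []≔-idempotent σ a ⟩
  σ [ a ]≔ inside
    ≡⟨ []≔-fixed {σ = σ} σ∋a ⟩
  σ ∎
  where
  open ≡.≡-Reasoning
  b≢a = ∋×∌⇒≢ {σ = σ} σ∋a σ∌b ∘ ≡.sym

-- The termination measure of the inductions that move one basis towards another.
⟨↦⟩-∖-⊂ : ∀ {n} (σ τ : Subset n) {i j} → σ ∋ i → τ ∋ j → σ ∌ j → ((τ ⟨ j ↦ i ⟩) ∩ ∁ σ) ⊂ (τ ∩ ∁ σ)
⟨↦⟩-∖-⊂ σ τ {i} {j} σ∋i τ∋j σ∌j = sub , j , x∈p∩q⁺ (lookup⇒[]= j τ τ∋j , x∉p⇒x∈∁p (∌⇒∉ σ∌j)) ,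
  λ j∈ → ∌⇒∉ (∌-⟨↦⟩ τ j≢i) (proj₁ (x∈p∩q⁻ _ _ j∈))
  where
  j≢i = ∋×∌⇒≢ {σ = σ} σ∋i σ∌j ∘ ≡.sym
  sub : ∀ {x} → x ∈ (τ ⟨ j ↦ i ⟩) ∩ ∁ σ → x ∈ τ ∩ ∁ σ
  sub {x} x∈ = x∈p∩q⁺ (lookup⇒[]= x τ (≡.trans (≡.sym (lookup-⟨↦⟩ τ x≢j x≢i)) ([]=⇒lookup x∈τ′)) , x∈∁σ)
    where
    x∈τ′ = proj₁ (x∈p∩q⁻ (τ ⟨ j ↦ i ⟩) (∁ σ) x∈)
    x∈∁σ = proj₂ (x∈p∩q⁻ (τ ⟨ j ↦ i ⟩) (∁ σ) x∈)
    x≢i : x ≢ i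
    x≢i refl = x∈∁p⇒x∉p x∈∁σ (lookup⇒[]= x σ σ∋i)
    x≢j : x ≢ j
    x≢j refl = ∌⇒∉ (∌-⟨↦⟩ τ j≢i) x∈τ′

⟨↦⟩-cross : ∀ {n} (σ : Subset n) {a b c e} → σ ∋ a → σ ∋ b → a ≢ b → σ ∌ c → σ ∌ e →
            σ ⟨ a ↦ c ⟩ ⟨ b ↦ e ⟩ ≡ σ ⟨ a ↦ e ⟩ ⟨ b ↦ c ⟩
⟨↦⟩-cross σ {c = c} {e} σ∋a σ∋b a≢b σ∌c σ∌e =
  ≡.trans (≡.sym (∖-⟪⟫ σ σ∋a σ∋b a≢b σ∌c)) (≡.trans (⟪⟫-sym _ c e) (∖-⟪⟫ σ σ∋a σ∋b a≢b σ∌e))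

-- Enumeration of all subsets.

sides : List Bool
sides = outside ∷ inside ∷ []

∈-sides : ∀ s → s List.∈ sides
∈-sides outside = here refl
∈-sides inside  = there (here refl)

subsets : ∀ n → List (Subset n)
subsets ℕ.zero    = [] ∷ []
subsets (ℕ.suc n) = cartesianProductWith _∷_ sides (subsets n)

∈-subsets : ∀ {n} (σ : Subset n) → σ List.∈ subsets n
∈-subsets []      = here refl
∈-subsets {ℕ.suc n} (s ∷ σ) = ∈-cartesianProductWith⁺ _∷_ {xs = sides} {ys = subsets n} (∈-sides s) (∈-subsets σ)

-- Ordered field arithmetic, linear forms on indicator vectors, minimisers, potentials on graphs.

module Reals (ℝ : RealField) where
  open RealField ℝ hiding (zero; _-_) renaming (refl to ≈-refl; sym to ≈-sym; trans to ≈-trans)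
  open Valuations ℝ using (⟨_,_⟩; e)
  open SemiringSum semiring using (sum-cong-≋; ∑-distrib-+; *-distribˡ-sum)

  open IsDecTotalOrder isDecTotalOrder public
    using (_≤?_)
    renaming (trans to ≤-trans; antisym to ≤-antisym; reflexive to ≤-reflexive; refl to ≤-refl)
  open Solver commutativeSemiring public using (solve; _:=_; _:+_)

  totalOrder : TotalOrder 0ℓ 0ℓ 0ℓ
  totalOrder = record { isTotalOrder = IsDecTotalOrder.isTotalOrder isDecTotalOrder }

  open TotalOrderProperties totalOrder public using (≰⇒≥)

  ≤-respʳ : ∀ {x y z} → y ≈ z → x ≤ y → x ≤ z
  ≤-respʳ y≈z x≤y = ≤-trans x≤y (≤-reflexive y≈z)

  ≤-respˡ : ∀ {x y z} → x ≈ y → x ≤ z → y ≤ z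
  ≤-respˡ x≈y x≤z = ≤-trans (≤-reflexive (≈-sym x≈y)) x≤z

  +-monoʳ-≤ : ∀ {x y} z → x ≤ y → z + x ≤ z + y
  +-monoʳ-≤ z x≤y = ≤-respˡ (+-comm _ z) (≤-respʳ (+-comm _ z) (+-monoˡ-≤ z x≤y))

  +-mono-≤ : ∀ {x y z w} → x ≤ y → z ≤ w → x + z ≤ y + w
  +-mono-≤ x≤y z≤w = ≤-trans (+-monoˡ-≤ _ x≤y) (+-monoʳ-≤ _ z≤w)

  x+z-z≈x : ∀ x z → (x + z) + - z ≈ x
  x+z-z≈x x z = ≈-trans (+-assoc x z (- z)) (≈-trans (+-congˡ (-‿inverseʳ z)) (+-identityʳ x))

  +-cancelʳ-≤ : ∀ {x y} z → x + z ≤ y + z → x ≤ y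
  +-cancelʳ-≤ z le = ≤-respˡ (x+z-z≈x _ z) (≤-respʳ (x+z-z≈x _ z) (+-monoˡ-≤ (- z) le))

  -- Inequalities are derived Farkas style, with all terms moved to the side
  -- where they occur positively: what remains is an identity of semirings.
  ≤-by : ∀ {a b x y} → a ≤ b → x + b ≈ y + a → x ≤ y
  ≤-by {a} {b} {x} {y} a≤b eq = +-cancelʳ-≤ b (≤-respˡ (≈-sym eq) (+-monoʳ-≤ y a≤b))

  ≈-by : ∀ {a b x y} → a ≈ b → x + b ≈ y + a → x ≈ y
  ≈-by a≈b eq = ≤-antisym (≤-by (≤-reflexive a≈b) eq) (≤-by (≤-reflexive (≈-sym a≈b)) (≈-sym eq))

  module ℝ-Ring = RingProperties (CommutativeRing.ring commutativeRing)

  -- Otherwise `- 1#` would be nonnegative, and so would its square `1#`, which forces `0# ≈ 1#`.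
  1≰0 : ¬ (1# ≤ 0#)
  1≰0 1≤0 = 0≉1 (≤-antisym (≤-respʳ -1*-1≈1 (*-nonNeg 0≤-1 0≤-1)) 1≤0)
    where
    0≤-1 : 0# ≤ - 1#
    0≤-1 = ≤-respˡ (-‿inverseʳ 1#) (≤-respʳ (+-identityˡ (- 1#)) (+-monoˡ-≤ (- 1#) 1≤0))
    -1*-1≈1 : - 1# * - 1# ≈ 1#
    -1*-1≈1 = ≈-trans (ℝ-Ring.-1*x≈-x (- 1#)) (ℝ-Ring.-‿involutive 1#)

  0≤1 : 0# ≤ 1#
  0≤1 with 0# ≤? 1#
  ... | yes 0≤1 = 0≤1
  ... | no  0≰1 = contradiction (≰⇒≥ 0≰1) 1≰0

  neg₂-anti-≤ : ∀ {w x y z} → w + x ≤ y + z → - y + - z ≤ - w + - x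
  neg₂-anti-≤ le = ≤-by le (≈-trans (inverse₂ _ _) (≈-sym (inverse₂ _ _)))
    where
    inverse₂ : ∀ x y → - x + - y + (x + y) ≈ 0#
    inverse₂ x y = ≈-trans (+-congʳ (ℝ-Ring.-‿+-comm x y)) (-‿inverseˡ (x + y))

  neg₂-anti-≤⁻¹ : ∀ {w x y z} → - w + - x ≤ - y + - z → y + z ≤ w + x
  neg₂-anti-≤⁻¹ le = ≤-by le (≈-trans (inverse₂ _ _) (≈-sym (inverse₂ _ _)))
    where
    inverse₂ : ∀ x y → x + y + (- x + - y) ≈ 0#
    inverse₂ x y = ≈-trans (+-congˡ (ℝ-Ring.-‿+-comm x y)) (-‿inverseʳ (x + y))

  lin : ∀ {n} → Vector Carrier n → Subset n → Carrier
  lin c σ = ⟨ c , e σ ⟩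

  lin-insert : ∀ {n} (c : Vector Carrier n) σ x → σ ∌ x → lin c (σ [ x ]≔ inside) ≈ lin c σ + c x
  lin-insert c (outside ∷ σ) zero _ = begin
    c zero * 1# + lin (tail c) σ            ≈⟨ +-cong (*-identityʳ _) ≈-refl ⟩
    c zero + lin (tail c) σ                 ≈⟨ +-comm _ _ ⟩
    lin (tail c) σ + c zero                 ≈⟨ +-congʳ (≈-sym (+-identityˡ _)) ⟩
    0# + lin (tail c) σ + c zero            ≈⟨ +-congʳ (+-congʳ (≈-sym (zeroʳ _))) ⟩
    c zero * 0# + lin (tail c) σ + c zero   ∎
    where open SetoidReasoning setoid
  lin-insert c (s ∷ σ) (suc x) σ∌x =
    ≈-trans (+-congˡ (lin-insert (tail c) σ x σ∌x)) (≈-sym (+-assoc _ _ _))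

  lin-swap : ∀ {n} (c : Vector Carrier n) σ {a b} → σ ∋ a → σ ∌ b →
             lin c (σ ⟨ a ↦ b ⟩) + c a ≈ lin c σ + c b
  lin-swap c σ {a} {b} σ∋a σ∌b = begin
    lin c (σ ⟨ a ↦ b ⟩) + c a     ≈⟨ +-congʳ (lin-insert c σ∖a b (≡.trans (lookup-∖ b (∋×∌⇒≢ {σ = σ} σ∋a σ∌b)) σ∌b)) ⟩
    lin c σ∖a + c b + c a         ≈⟨ solve 3 (λ x y z → x :+ y :+ z := x :+ z :+ y) ≈-refl (lin c σ∖a) (c b) (c a) ⟩
    lin c σ∖a + c a + c b         ≈⟨ +-congʳ (≈-sym (lin-insert c σ∖a a (lookup∘update a σ outside))) ⟩
    lin c (σ∖a [ a ]≔ inside) + c b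
      ≡⟨ cong (λ τ → lin c τ + c b) (≡.trans ([]≔-idempotent σ a) ([]≔-fixed {σ = σ} σ∋a)) ⟩
    lin c σ + c b                 ∎
    where
    open SetoidReasoning setoid
    σ∖a = σ [ a ]≔ outside
    lookup-∖ : ∀ x → a ≢ x → lookup σ∖a x ≡ lookup σ x
    lookup-∖ x a≢x = lookup∘update′ (a≢x ∘ ≡.sym) σ outside

  lin-⟪⟫ : ∀ {n} (c : Vector Carrier n) S {a b} → S ∌ a → S ∌ b → a ≢ b →
           lin c (S ⟪ a , b ⟫) ≈ lin c S + c a + c b
  lin-⟪⟫ c S {a} {b} S∌a S∌b a≢b = ≈-trans
    (lin-insert c (S [ a ]≔ inside) b (≡.trans (lookup∘update′ (a≢b ∘ ≡.sym) S inside) S∌b))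
    (+-congʳ (lin-insert c S a S∌a))

  open Extrema totalOrder using (argmin; argmin-all; f[argmin]≤f[xs])

  minimiser : ∀ {A : Set} (xs : List A) {P : Pred A 0ℓ} → Decidable P → (f : A → Carrier) → Satisfiable P →
              ∃[ x ] P x × (∀ y → y List.∈ xs → P y → f x ≤ f y)
  minimiser xs P? f (x , Px) =
    argmin f x (filter P? xs) ,
    argmin-all f Px (all-filter P? xs) ,
    λ y y∈xs Py → All.lookup (f[argmin]≤f[xs] x (filter P? xs)) (∈-filter⁺ P? y∈xs Py)

  -- The edges are processed one at a time: comp labels the components of the
  -- balanced edges found so far, and an edge between two components is balanced
  -- by shifting the potential on one of them.
  module Potentials {n} (Edge : Rel (Fin n) 0ℓ) (edge? : ∀ i j → Dec (Edge i j))
                    (weight : Fin n → Fin n → Carrier) (base : Carrier) where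

    Balanced : Vector Carrier n → Rel (Fin n) 0ℓ
    Balanced p i j = weight i j + p j ≈ base + p i

    BalancedEdge : Vector Carrier n → Rel (Fin n) 0ℓ
    BalancedEdge p i j = Edge i j × Balanced p i j

    private
      Link : Vector Carrier n → (Fin n → Fin n) → Rel (Fin n) 0ℓ
      Link p comp i j = BalancedEdge p i j × comp i ≡ comp j

      record State (xs : List (Fin n × Fin n)) : Set where
        field
          p         : Vector Carrier n
          comp      : Fin n → Fin n
          links     : All (λ (i , j) → Edge i j → Link p comp i j) xs
          connected : ∀ x y → comp x ≡ comp y → EqClosure (Link p comp) x y

      initial : State []
      initial = record { p = λ _ → 0# ; comp = id ; links = [] ; connected = λ { x _ refl → ε } }

      module Merge {xs} (st : State xs) {i j} (ij : Edge i j) where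
        open State st

        -- The discrepancy of the edge from `i` to `j`: adding it to the potential on the component
        -- of `j` balances this edge.
        δ : Carrier
        δ = base + p i + - (weight i j + p j)

        shift : Fin n → Carrier
        shift c with c ≟ comp j
        ... | yes _ = δ
        ... | no  _ = 0#

        merge : Fin n → Fin n
        merge c with c ≟ comp j
        ... | yes _ = comp i
        ... | no  _ = c

        shift-j : shift (comp j) ≡ δ
        shift-j with comp j ≟ comp j
        ... | yes _  = refl
        ... | no j≢j = contradiction refl j≢j

        merge-j : merge (comp j) ≡ comp i
        merge-j with comp j ≟ comp j
        ... | yes _  = refl
        ... | no j≢j = contradiction refl j≢j

        module _ {c} (c≢j : c ≢ comp j) where
          shift-≢ : shift c ≡ 0#
          shift-≢ with c ≟ comp j
          ... | yes c≡j = contradiction c≡j c≢j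
          ... | no  _   = refl

          merge-≢ : merge c ≡ c
          merge-≢ with c ≟ comp j
          ... | yes c≡j = contradiction c≡j c≢j
          ... | no  _   = refl

        p′ : Vector Carrier n
        p′ x = p x + shift (comp x)

        comp′ : Fin n → Fin n
        comp′ = merge ∘ comp

        -- Both ends of a link lie in one component, so they are shifted by the same amount.
        Link⇒Link′ : ∀ {x y} → Link p comp x y → Link p′ comp′ x y
        Link⇒Link′ {x} {y} ((xy , balanced) , eq) =
          (xy , ≈-trans (≈-sym (+-assoc _ _ _))
                  (≈-trans (+-cong balanced (reflexive (cong shift (≡.sym eq)))) (+-assoc _ _ _))) ,
          cong merge eq

        link-ij : comp i ≢ comp j → Link p′ comp′ i j
        link-ij i≢j = (ij , balanced) , ≡.trans (merge-≢ i≢j) (≡.sym merge-j)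
          where
          balanced : weight i j + (p j + shift (comp j)) ≈ base + (p i + shift (comp i))
          balanced = begin
            weight i j + (p j + shift (comp j)) ≡⟨ cong (λ s → weight i j + (p j + s)) shift-j ⟩
            weight i j + (p j + δ)              ≈⟨ ≈-sym (+-assoc _ _ _) ⟩
            weight i j + p j + δ                ≈⟨ +-comm _ _ ⟩
            δ + (weight i j + p j)              ≈⟨ +-assoc _ _ _ ⟩
            base + p i + (- (weight i j + p j) + (weight i j + p j)) ≈⟨ +-congˡ (-‿inverseˡ _) ⟩
            base + p i + 0#                     ≈⟨ +-assoc _ _ _ ⟩
            base + (p i + 0#)                   ≡⟨ cong (λ s → base + (p i + s)) (≡.sym (shift-≢ i≢j)) ⟩
            base + (p i + shift (comp i))       ∎
            where open SetoidReasoning setoid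

        merged : comp i ≢ comp j → State ((i , j) ∷ xs)
        merged i≢j = record
          { p         = p′
          ; comp      = comp′
          ; links     = (λ _ → link-ij i≢j) ∷ All.map (λ link → Link⇒Link′ ∘ link) links
          ; connected = connected′
          }
          where
          old : ∀ x y → comp x ≡ comp y → EqClosure (Link p′ comp′) x y
          old x y eq = EqClosure.map Link⇒Link′ (connected x y eq)
          connected′ : ∀ x y → comp′ x ≡ comp′ y → EqClosure (Link p′ comp′) x y
          connected′ x y eq with comp x ≟ comp j | comp y ≟ comp j
          ... | yes x~j | yes y~j = old x y (≡.trans x~j (≡.sym y~j))
          ... | no  x≁j | no  y≁j = old x y eq
          ... | yes x~j | no  y≁j = old x j x~j ◅◅ bwd (link-ij i≢j) ◅ old i y eq
          ... | no  x≁j | yes y~j = old x i eq ◅◅ fwd (link-ij i≢j) ◅ old j y (≡.sym y~j)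

    module _ (closed : ∀ p {i j} → EqClosure (BalancedEdge p) i j → Edge i j → Balanced p i j) where

      private
        process : ∀ xs → State xs
        process []             = initial
        process ((i , j) ∷ xs) with process xs | edge? i j
        ... | st | no ¬ij = record { State st ; links = (λ ij → contradiction ij ¬ij) ∷ State.links st }
        ... | st | yes ij with State.comp st i ≟ State.comp st j
        ...   | no  i≁j = Merge.merged st ij i≁j
        ...   | yes i~j = record { State st ; links = (λ _ → (ij , balanced) , i~j) ∷ State.links st }
          where
          balanced = closed (State.p st) (EqClosure.map proj₁ (State.connected st i j i~j)) ij

      -- The hypothesis `closed` is the cycle condition. It settles the edges whose ends are already
      -- connected by balanced edges; every other edge is balanced by a merge.
      potential : ∃[ p ] (∀ {i j} → Edge i j → Balanced p i j)
      potential = State.p st , λ {i} {j} ij →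
        proj₂ (proj₁ (All.lookup (State.links st) (∈-cartesianProduct⁺ (∈-allFin i) (∈-allFin j)) ij))
        where st = process (cartesianProduct (allFin n) (allFin n))

  lin-* : ∀ {n} a (c : Vector Carrier n) σ → lin (λ t → a * c t) σ ≈ a * lin c σ
  lin-* a c σ = ≈-trans (sum-cong-≋ (λ t → *-assoc a (c t) (e σ t)))
                        (≈-sym (*-distribˡ-sum a (λ t → c t * e σ t)))

  lin-+ : ∀ {n} (c c′ : Vector Carrier n) σ → lin (λ t → c t + c′ t) σ ≈ lin c σ + lin c′ σ
  lin-+ c c′ σ = ≈-trans (sum-cong-≋ (λ t → distribʳ (e σ t) (c t) (c′ t)))
                         (∑-distrib-+ (λ t → c t * e σ t) (λ t → c′ t * e σ t))

-- Convex hulls and their faces.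

module Convexity (ℝ : RealField) where
  open RealField ℝ hiding (zero; _-_) renaming (refl to ≈-refl; sym to ≈-sym; trans to ≈-trans)
  open Reals ℝ
  open Valuations ℝ using (⟨_,_⟩; conv; face)
  open SemiringSum semiring using (sum-cong-≋; *-distribˡ-sum; *-distribʳ-sum; ∑-comm)

  ≤⇒0≤ : ∀ {x y} → x ≤ y → 0# ≤ y + - x
  ≤⇒0≤ {x} x≤y = ≤-respˡ (-‿inverseʳ x) (+-monoˡ-≤ (- x) x≤y)

  *-monoˡ-≤ : ∀ {a x y} → 0# ≤ a → x ≤ y → a * x ≤ a * y
  *-monoˡ-≤ {a} {x} {y} 0≤a x≤y = ≤-respˡ (+-identityˡ (a * x))
    (≤-respʳ eq (+-monoˡ-≤ (a * x) (*-nonNeg 0≤a (≤⇒0≤ x≤y))))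
    where
    eq : a * (y + - x) + a * x ≈ a * y
    eq = ≈-trans (≈-sym (distribˡ a _ _)) (*-congˡ
      (≈-trans (+-assoc y (- x) x) (≈-trans (+-congˡ (-‿inverseˡ x)) (+-identityʳ y))))

  sum-mono-≤ : ∀ {k} {f g : Vector Carrier k} → (∀ a → f a ≤ g a) → sum f ≤ sum g
  sum-mono-≤ {ℕ.zero}  f≤g = ≤-refl
  sum-mono-≤ {ℕ.suc k} f≤g = +-mono-≤ (f≤g zero) (sum-mono-≤ (f≤g ∘ suc))

  -- A strict increase in one term could only be offset by a decrease in another, which the termwise
  -- bound forbids.
  sum-squeeze : ∀ {k} {f g : Vector Carrier k} → (∀ a → f a ≤ g a) → sum g ≤ sum f → ∀ a → f a ≈ g a
  sum-squeeze {ℕ.suc k} {f} {g} f≤g Σg≤Σf zero = ≤-antisym (f≤g zero)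
    (+-cancelʳ-≤ (sum (g ∘ suc)) (≤-trans Σg≤Σf (+-monoʳ-≤ (f zero) (sum-mono-≤ (f≤g ∘ suc)))))
  sum-squeeze {ℕ.suc k} {f} {g} f≤g Σg≤Σf (suc a) = sum-squeeze (f≤g ∘ suc)
    (≤-by (+-mono-≤ Σg≤Σf (f≤g zero))
      (solve 4 (λ f₀ g₀ F G → G :+ (f₀ :+ F :+ g₀) := F :+ (g₀ :+ G :+ f₀)) ≈-refl
        (f zero) (g zero) (sum (f ∘ suc)) (sum (g ∘ suc)))) a

  *-cancelʳ-0 : ∀ {a x y} → a * x ≈ a * y → ¬ (x ≈ y) → a ≈ 0#
  *-cancelʳ-0 {a} {x} {y} ax≈ay x≉y with inverse (x + - y) x-y≉0
    where
    x-y≉0 : ¬ (x + - y ≈ 0#)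
    x-y≉0 eq = x≉y (≈-trans (≈-sym (+-identityʳ x)) (≈-trans (+-congˡ (≈-sym (-‿inverseˡ y)))
      (≈-trans (≈-sym (+-assoc x (- y) y)) (≈-trans (+-congʳ eq) (+-identityˡ y)))))
  ... | z , xz≈1 = begin
    a                     ≈⟨ ≈-sym (*-identityʳ a) ⟩
    a * 1#                ≈⟨ *-congˡ (≈-sym xz≈1) ⟩
    a * ((x + - y) * z)   ≈⟨ ≈-sym (*-assoc a _ z) ⟩
    a * (x + - y) * z     ≈⟨ *-congʳ (distribˡ a x (- y)) ⟩
    (a * x + a * - y) * z ≈⟨ *-congʳ (+-cong ax≈ay (≈-sym (ℝ-Ring.-‿distribʳ-* a y))) ⟩
    (a * y + - (a * y)) * z ≈⟨ *-congʳ (-‿inverseʳ (a * y)) ⟩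
    0# * z                ≈⟨ zeroˡ z ⟩
    0#                    ∎
    where open SetoidReasoning setoid

  combination : ∀ {k m} → Vector Carrier k → (Fin k → Vector Carrier m) → Vector Carrier m
  combination w p t = sum (λ a → w a * p a t)

  ⟨⟩-cong : ∀ {m} (c : Vector Carrier m) {x y} → x ≋ y → ⟨ c , x ⟩ ≈ ⟨ c , y ⟩
  ⟨⟩-cong c x≋y = sum-cong-≋ (λ t → *-congˡ (x≋y t))

  ⟨⟩-combination : ∀ {k m} (c : Vector Carrier m) (w : Vector Carrier k) p →
                   ⟨ c , combination w p ⟩ ≈ sum (λ a → w a * ⟨ c , p a ⟩)
  ⟨⟩-combination {k} {m} c w p = begin
    sum (λ t → c t * sum (λ a → w a * p a t))
      ≈⟨ sum-cong-≋ (λ t → *-distribˡ-sum (c t) (λ a → w a * p a t)) ⟩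
    sum (λ t → sum (λ a → c t * (w a * p a t)))
      ≈⟨ ∑-comm (λ t a → c t * (w a * p a t)) ⟩
    sum (λ a → sum (λ t → c t * (w a * p a t)))
      ≈⟨ sum-cong-≋ (λ a → sum-cong-≋ (λ t → x*yz≈y*xz (c t) (w a) (p a t))) ⟩
    sum (λ a → sum (λ t → w a * (c t * p a t)))
      ≈⟨ sum-cong-≋ (λ a → ≈-sym (*-distribˡ-sum (w a) (λ t → c t * p a t))) ⟩
    sum (λ a → w a * ⟨ c , p a ⟩) ∎
    where
    open SetoidReasoning setoid
    x*yz≈y*xz : ∀ x y z → x * (y * z) ≈ y * (x * z)
    x*yz≈y*xz x y z = ≈-trans (≈-sym (*-assoc x y z)) (≈-trans (*-congʳ (*-comm x y)) (*-assoc y x z))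

  conv-mono : ∀ {m} {A B : Pred (Vector Carrier m) 0ℓ} → A ⊆ B → conv A ⊆ conv B
  conv-mono A⊆B (k , p , w , Ap , w≥0 , Σw≈1 , x≋) = k , p , w , (λ a → A⊆B (Ap a)) , w≥0 , Σw≈1 , x≋

  ∈⇒∈-conv : ∀ {m} {A : Pred (Vector Carrier m) 0ℓ} → A ⊆ conv A
  ∈⇒∈-conv {x = x} Ax = 1 , (λ _ → x) , (λ _ → 1#) , (λ _ → Ax) , (λ _ → 0≤1) , +-identityʳ 1# ,
    λ t → ≈-sym (≈-trans (+-identityʳ _) (*-identityˡ (x t)))

  sum-weights : ∀ {k} (w : Vector Carrier k) s → sum w ≈ 1# → sum (λ a → w a * s) ≈ s
  sum-weights w s Σw≈1 = ≈-trans (≈-sym (*-distribʳ-sum s w)) (≈-trans (*-congʳ Σw≈1) (*-identityˡ s))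

  module _ {m} {A : Pred (Vector Carrier m) 0ℓ} (c : Vector Carrier m) {s : Carrier} where

    conv-≥ : (∀ x → A x → s ≤ ⟨ c , x ⟩) → ∀ y → conv A y → s ≤ ⟨ c , y ⟩
    conv-≥ s≤ y (k , p , w , Ap , w≥0 , Σw≈1 , y≋) =
      ≤-respˡ (sum-weights w s Σw≈1) (≤-respʳ
        (≈-sym (≈-trans (⟨⟩-cong c y≋) (⟨⟩-combination c w p)))
        (sum-mono-≤ (λ a → *-monoˡ-≤ (w≥0 a) (s≤ (p a) (Ap a)))))

    conv-≤ : (∀ x → A x → ⟨ c , x ⟩ ≤ s) → ∀ y → conv A y → ⟨ c , y ⟩ ≤ s
    conv-≤ ≤s y (k , p , w , Ap , w≥0 , Σw≈1 , y≋) =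
      ≤-respʳ (sum-weights w s Σw≈1) (≤-respˡ
        (≈-sym (≈-trans (⟨⟩-cong c y≋) (⟨⟩-combination c w p)))
        (sum-mono-≤ (λ a → *-monoˡ-≤ (w≥0 a) (≤s (p a) (Ap a)))))

  ArgMin : ∀ {m} → Pred (Vector Carrier m) 0ℓ → Vector Carrier m → Pred (Vector Carrier m) 0ℓ
  ArgMin A c x = A x × (∀ z → A z → ⟨ c , x ⟩ ≤ ⟨ c , z ⟩)

  face-conv : ∀ {m} (A : Pred (Vector Carrier m) 0ℓ) c → Satisfiable (ArgMin A c) →
              face (conv A) c ≐ conv (ArgMin A c)
  face-conv {m} A c (x₀ , Ax₀ , min₀) = face⊆ , face⊇
    where
    s : Carrier
    s = ⟨ c , x₀ ⟩

    face⊇ : conv (ArgMin A c) ⊆ face (conv A) c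
    face⊇ {y} y∈ = conv-mono {A = ArgMin A c} proj₁ y∈ , λ z z∈ →
      ≤-trans (conv-≤ {A = ArgMin A c} c (λ x (_ , minx) → minx x₀ Ax₀) y y∈) (conv-≥ {A = A} c min₀ z z∈)

    face⊆ : face (conv A) c ⊆ conv (ArgMin A c)
    -- A point of positive weight is a minimiser; the others are replaced by x₀.
    face⊆ {y} ((k , p , w , Ap , w≥0 , Σw≈1 , y≋) , miny) =
      k , p′ , w , argmin , w≥0 , Σw≈1 ,
      λ t → ≈-trans (y≋ t) (sum-cong-≋ (λ a → agree a t (⟨ c , p a ⟩ ≤? s)))
      where
      choose : ∀ a → Dec (⟨ c , p a ⟩ ≤ s) → Vector Carrier m
      choose a (yes _) = p a
      choose a (no _)  = x₀

      p′ : Fin k → Vector Carrier m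
      p′ a = choose a (⟨ c , p a ⟩ ≤? s)

      argmin : ∀ a → ArgMin A c (p′ a)
      argmin a with ⟨ c , p a ⟩ ≤? s
      ... | yes ≤s = Ap a , λ z Az → ≤-trans ≤s (min₀ z Az)
      ... | no  _  = Ax₀ , min₀

      -- Termwise the right side dominates, by minimality of `s` on `A`; in total it does not exceed
      -- `s`, since `y` minimises over a hull containing `x₀`. Hence every term is an equality.
      squeezed : ∀ a → w a * s ≈ w a * ⟨ c , p a ⟩
      squeezed = sum-squeeze (λ a → *-monoˡ-≤ (w≥0 a) (min₀ (p a) (Ap a)))
        (≤-respˡ (≈-trans (⟨⟩-cong c y≋) (⟨⟩-combination c w p))
          (≤-respʳ (≈-sym (sum-weights w s Σw≈1)) (miny x₀ (∈⇒∈-conv {A = A} Ax₀))))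

      agree : ∀ a t (d : Dec (⟨ c , p a ⟩ ≤ s)) → w a * p a t ≈ w a * choose a d t
      agree a t (yes _) = ≈-refl
      agree a t (no ≰s) = ≈-trans (≈-trans (*-congʳ wa≈0) (zeroˡ _)) (≈-sym (≈-trans (*-congʳ wa≈0) (zeroˡ _)))
        where
        wa≈0 : w a ≈ 0#
        wa≈0 = *-cancelʳ-0 (squeezed a) (λ s≈ → ≰s (≤-reflexive (≈-sym s≈)))

-- From the three-term relations to the exchange property of valuated matroids.

module ValuatedExchange (ℝ : RealField) {n d} (M : Matroid n d) where
  open RealField ℝ hiding (zero; _-_) renaming (refl to ≈-refl; sym to ≈-sym; trans to ≈-trans)
  open Reals ℝ
  open Matroid M

  Pair : Rel Carrier 0ℓ → (Subset n → Carrier) → Carrier → Subset n → Subset n → Set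
  Pair _∼_ F s σ τ = Basis σ × Basis τ × (F σ + F τ) ∼ s

  -- With _∼_ = _≤_ these are the three-term relations: the minimum is attained
  -- twice iff each finite term is bounded below by one of the other two.
  Local : Rel Carrier 0ℓ → (Subset n → Carrier) → Set
  Local _∼_ F = ∀ S {a b c e} → Quad S a b c e → Basis (S ⟪ a , b ⟫) → Basis (S ⟪ c , e ⟫) →
    let s = F (S ⟪ a , b ⟫) + F (S ⟪ c , e ⟫) in
    Pair _∼_ F s (S ⟪ a , c ⟫) (S ⟪ b , e ⟫) ⊎ Pair _∼_ F s (S ⟪ a , e ⟫) (S ⟪ b , c ⟫)

  module _ {_∼_ : Rel Carrier 0ℓ} {F : Subset n → Carrier} (local : Local _∼_ F)
           (σ : Subset n) {a b c e : Fin n} (σ∋a : σ ∋ a) (σ∋b : σ ∋ b) (σ∌c : σ ∌ c) (σ∌e : σ ∌ e)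
           (a≢b : a ≢ b) (c≢e : c ≢ e) where
    private
      S = σ [ a ]≔ outside [ b ]≔ outside
      q = quad-∖ σ σ∋a σ∋b σ∌c σ∌e a≢b c≢e
      ab = ∖-⟪₁₂⟫ σ σ∋a σ∋b a≢b
      ce = ∖-⟪⟫ σ σ∋a σ∋b a≢b {c} {e} σ∌c
      ac = ∖-⟪₁⟫ σ σ∋a σ∋b a≢b c
      ae = ∖-⟪₁⟫ σ σ∋a σ∋b a≢b e
      bc = ∖-⟪₂⟫ σ σ∋a σ∋b a≢b c
      be = ∖-⟪₂⟫ σ σ∋a σ∋b a≢b e

    -- The six sets of the relation over `S` are `σ`, four of its neighbours and one double
    -- exchange. `local-double` reads the relation from the term containing `σ`, `local-cross` from
    -- a term made of two neighbours.
    local-double : Basis σ → Basis (σ ⟨ a ↦ c ⟩ ⟨ b ↦ e ⟩) →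
      let s = F σ + F (σ ⟨ a ↦ c ⟩ ⟨ b ↦ e ⟩) in
      Pair _∼_ F s (σ ⟨ b ↦ c ⟩) (σ ⟨ a ↦ e ⟩) ⊎ Pair _∼_ F s (σ ⟨ b ↦ e ⟩) (σ ⟨ a ↦ c ⟩)
    local-double bσ bτ with local S q (subst Basis (≡.sym ab) bσ) (subst Basis (≡.sym ce) bτ)
    ... | r rewrite ab | ce | ac | ae | bc | be = r

    local-cross : Basis (σ ⟨ a ↦ c ⟩) → Basis (σ ⟨ b ↦ e ⟩) →
      let s = F (σ ⟨ a ↦ c ⟩) + F (σ ⟨ b ↦ e ⟩) in
      Pair _∼_ F s σ (σ ⟨ a ↦ c ⟩ ⟨ b ↦ e ⟩) ⊎ Pair _∼_ F s (σ ⟨ a ↦ e ⟩) (σ ⟨ b ↦ c ⟩)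
    local-cross bσ bτ
      with local S (swap₂₃ (swap₁₂ q)) (subst Basis (≡.sym bc) bσ) (subst Basis (≡.sym ae) bτ)
    ... | r rewrite ⟪⟫-sym S b a | ⟪⟫-sym S c a | ab | ce | ac | ae | bc | be = r

  exchange′ : ∀ {σ τ} → Basis σ → Basis τ → ∀ {i} → σ ∋ i → τ ∌ i →
              ∃[ j ] τ ∋ j × σ ∌ j × Basis (σ ⟨ i ↦ j ⟩)
  exchange′ {σ} {τ} bσ bτ {i} σ∋i τ∌i with exchange bσ bτ (lookup⇒[]= i σ σ∋i) (∌⇒∉ τ∌i)
  ... | j , j∈τ , j∉σ , b = j , []=⇒lookup j∈τ , ∉⇒∌ j∉σ , subst Basis (exchange-⟨↦⟩ σ i j) b

  -- An element of `τ` outside `σ` could be exchanged for an element of `σ` outside `τ`, which the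
  -- inclusion excludes.
  basis-⊆⇒≡ : ∀ {σ τ} → Basis σ → Basis τ → (∀ x → σ ∋ x → τ ∋ x) → σ ≡ τ
  basis-⊆⇒≡ {σ} {τ} bσ bτ σ⊆τ = lookup-injective σ τ same
    where
    same : ∀ x → lookup σ x ≡ lookup τ x
    same x with σ ∋? x | τ ∋? x
    ... | yes σ∋x | _       = ≡.trans σ∋x (≡.sym (σ⊆τ x σ∋x))
    ... | no  σ∌x | no  τ∌x = ≡.trans (¬∋⇒∌ {σ = σ} σ∌x) (≡.sym (¬∋⇒∌ {σ = τ} τ∌x))
    ... | no  σ∌x | yes τ∋x with exchange′ bτ bσ τ∋x (¬∋⇒∌ {σ = σ} σ∌x)
    ...   | y , σ∋y , τ∌y , _ = contradiction (σ⊆τ y σ∋y) (∌⇒¬∋ {σ = τ} τ∌y)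

  -- When `a` leaves the first basis, the element that enters lies in the second basis but not in
  -- the first, so it is `c` or `e`.
  pair-exchange : ∀ {S a b c e} → Quad S a b c e → Basis (S ⟪ a , b ⟫) → Basis (S ⟪ c , e ⟫) →
                  Basis (S ⟪ b , c ⟫) ⊎ Basis (S ⟪ b , e ⟫)
  pair-exchange {S} {a} {b} {c} {e} q bσ bτ
    with exchange′ bσ bτ (∋-⟪⟫₁ S a b) (≡.trans (lookup-⟪⟫ {S = S} ≢₁₃ ≢₁₄) ∌₁)
    where open Quad q
  ... | x , ∋x , ∌x , bx with ∋-⟪⟫⁻ S c e ∋x
  ...   | inj₁ refl = inj₁ (subst Basis (⟪⟫-⟨↦⟩ (Quad.∌₁ q) (Quad.≢₁₂ q)) bx)
  ...   | inj₂ (inj₁ refl) = inj₂ (subst Basis (⟪⟫-⟨↦⟩ (Quad.∌₁ q) (Quad.≢₁₂ q)) bx)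
  ...   | inj₂ (inj₂ S∋x) = contradiction S∋x (∌⇒¬∋ {σ = S} S∌x)
    where
    S∌x : S ∌ x
    S∌x with x ≟ a | x ≟ b
    ... | yes refl | _        = Quad.∌₁ q
    ... | no _     | yes refl = Quad.∌₂ q
    ... | no x≢a   | no x≢b   = ≡.trans (≡.sym (lookup-⟪⟫ {S = S} x≢a x≢b)) ∌x

  -- This supplies the induction below with a move of `τ` towards `σ` that does not insert `i`. If
  -- the first exchange does bring in `i`, a second one from there gives a basis with `j` and `j′`
  -- replaced by `i` and `k′`; comparing it with `τ` through `pair-exchange` yields a basis that
  -- takes in `k′` alone.
  exchange-avoiding : ∀ {σ τ} → Basis σ → Basis τ → ∀ {i i′} → σ ∋ i → τ ∌ i → σ ∋ i′ → τ ∌ i′ → i′ ≢ i →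
                      ∃[ k ] ∃[ j ] σ ∋ k × τ ∌ k × k ≢ i × τ ∋ j × σ ∌ j × Basis (τ ⟨ j ↦ k ⟩)
  exchange-avoiding {σ} {τ} bσ bτ {i} {i′} σ∋i τ∌i σ∋i′ τ∌i′ i′≢i
    with exchange′ bσ bτ σ∋i τ∌i
  ... | j , τ∋j , σ∌j , _ with exchange′ bτ bσ τ∋j σ∌j
  ...   | k , σ∋k , τ∌k , bk with k ≟ i
  ...     | no  k≢i  = k , j , σ∋k , τ∌k , k≢i , τ∋j , σ∌j , bk
  ...     | yes refl
    with exchange′ bσ bk σ∋i′ (≡.trans (lookup-⟨↦⟩ τ (∋×∌⇒≢ {σ = σ} σ∋i′ σ∌j) i′≢i) τ∌i′)
  ...       | j′ , τ₁∋j′ , σ∌j′ , _ with exchange′ bk bσ τ₁∋j′ σ∌j′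
  ...         | k′ , σ∋k′ , τ₁∌k′ , bk′ =
    [ (λ b → k′ , j′ , σ∋k′ , τ∌k′ , k′≢i , τ∋j′ , σ∌j′ , subst Basis k′j b)
    , (λ b → k′ , j , σ∋k′ , τ∌k′ , k′≢i , τ∋j , σ∌j , subst Basis k′j′ b)
    ]′ (pair-exchange (swap-pairs quadτ)
         (subst Basis ik′ bk′) (subst Basis jj′ bτ))
    where
    j′≢i : j′ ≢ i
    j′≢i = ∋×∌⇒≢ {σ = σ} σ∋i σ∌j′ ∘ ≡.sym
    j≢i : j ≢ i
    j≢i = ∋×∌⇒≢ {σ = σ} σ∋i σ∌j ∘ ≡.sym
    j≢j′ : j ≢ j′
    j≢j′ = ∋×∌⇒≢ {σ = τ ⟨ j ↦ i ⟩} τ₁∋j′ (∌-⟨↦⟩ τ j≢i) ∘ ≡.sym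
    τ∋j′ : τ ∋ j′
    τ∋j′ = ≡.trans (≡.sym (lookup-⟨↦⟩ τ (j≢j′ ∘ ≡.sym) j′≢i)) τ₁∋j′
    k′≢i : k′ ≢ i
    k′≢i = ∋×∌⇒≢ {σ = τ ⟨ j ↦ i ⟩} (∋-⟨↦⟩ τ j i) τ₁∌k′ ∘ ≡.sym
    τ∌k′ : τ ∌ k′
    τ∌k′ = ≡.trans (≡.sym (lookup-⟨↦⟩ τ (∋×∌⇒≢ {σ = σ} σ∋k′ σ∌j) k′≢i)) τ₁∌k′
    quadτ : Quad (τ [ j ]≔ outside [ j′ ]≔ outside) j j′ i k′
    quadτ = quad-∖ τ τ∋j τ∋j′ τ∌i τ∌k′ j≢j′ (k′≢i ∘ ≡.sym)
    ik′ : τ ⟨ j ↦ i ⟩ ⟨ j′ ↦ k′ ⟩ ≡ τ [ j ]≔ outside [ j′ ]≔ outside ⟪ i , k′ ⟫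
    ik′ = ≡.sym (∖-⟪⟫ τ τ∋j τ∋j′ j≢j′ τ∌i)
    jj′ : τ ≡ τ [ j ]≔ outside [ j′ ]≔ outside ⟪ j , j′ ⟫
    jj′ = ≡.sym (∖-⟪₁₂⟫ τ τ∋j τ∋j′ j≢j′)
    k′j : τ [ j ]≔ outside [ j′ ]≔ outside ⟪ k′ , j ⟫ ≡ τ ⟨ j′ ↦ k′ ⟩
    k′j = ≡.trans (⟪⟫-sym _ k′ j) (∖-⟪₁⟫ τ τ∋j τ∋j′ j≢j′ k′)
    k′j′ : τ [ j ]≔ outside [ j′ ]≔ outside ⟪ k′ , j′ ⟫ ≡ τ ⟨ j ↦ k′ ⟩
    k′j′ = ≡.trans (⟪⟫-sym _ k′ j′) (∖-⟪₂⟫ τ τ∋j τ∋j′ j≢j′ k′)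

  _+lin_ : (Subset n → Carrier) → Vector Carrier n → Subset n → Carrier
  (F +lin c) σ = F σ + lin c σ

  -- The linear part of each term is twice `lin c S` plus the coefficients of the four elements, so
  -- all terms shift equally. The comparison is a parameter in order to cover both `_≤_` and its
  -- reverse.
  local-+lin : ∀ {_∼_ : Rel Carrier 0ℓ} → (∀ {x y z w} → x ≈ y → z ≈ w → x ∼ z → y ∼ w) →
               (∀ {x y} z → x ∼ y → (x + z) ∼ (y + z)) →
               ∀ F c → Local _∼_ F → Local _∼_ (F +lin c)
  local-+lin {_∼_} resp mono F c local S {a} {b} {x} {y} q bσ bτ =
    Sum.map
      (λ { (b₁ , b₂ , le) → b₁ , b₂ , shift le (pair-sum ∌₁ ∌₃ ≢₁₃ ∌₂ ∌₄ ≢₂₄)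
             (solve 5 (λ s t u v w → s :+ t :+ u :+ (s :+ v :+ w) := s :+ t :+ v :+ (s :+ u :+ w)) ≈-refl
                (lin c S) (c a) (c b) (c x) (c y)) })
      (λ { (b₁ , b₂ , le) → b₁ , b₂ , shift le (pair-sum ∌₁ ∌₄ ≢₁₄ ∌₂ ∌₃ ≢₂₃)
             (solve 5 (λ s t u v w → s :+ t :+ u :+ (s :+ v :+ w) := s :+ t :+ w :+ (s :+ u :+ v)) ≈-refl
                (lin c S) (c a) (c b) (c x) (c y)) })
      (local S q bσ bτ)
    where
    open Quad q
    pair-sum : ∀ {i j k l} → S ∌ i → S ∌ j → i ≢ j → S ∌ k → S ∌ l → k ≢ l →
               lin c (S ⟪ i , j ⟫) + lin c (S ⟪ k , l ⟫) ≈ lin c S + c i + c j + (lin c S + c k + c l)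
    pair-sum ∌i ∌j i≢j ∌k ∌l k≢l = +-cong (lin-⟪⟫ c S ∌i ∌j i≢j) (lin-⟪⟫ c S ∌k ∌l k≢l)
    shift : ∀ {f₁ f₂ l₁ l₂ r} → (f₁ + f₂) ∼ (F (S ⟪ a , b ⟫) + F (S ⟪ x , y ⟫)) →
            l₁ + l₂ ≈ r → lin c S + c a + c b + (lin c S + c x + c y) ≈ r →
            (f₁ + l₁ + (f₂ + l₂)) ∼ ((F +lin c) (S ⟪ a , b ⟫) + (F +lin c) (S ⟪ x , y ⟫))
    shift {f₁} {f₂} {l₁} {l₂} {r} le l≈r r≈ =
      resp (≈-trans (+-congˡ l≈r′) (interchange f₁ f₂ l₁ l₂)) (interchange _ _ _ _) (mono _ le)
      where
      interchange : ∀ p q s t → p + q + (s + t) ≈ p + s + (q + t)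
      interchange = solve 4 (λ p q s t → p :+ q :+ (s :+ t) := p :+ s :+ (q :+ t)) ≈-refl
      l≈r′ : lin c (S ⟪ a , b ⟫) + lin c (S ⟪ x , y ⟫) ≈ l₁ + l₂
      l≈r′ = ≈-trans (pair-sum ∌₁ ∌₂ ≢₁₂ ∌₃ ∌₄ ≢₃₄) (≈-trans r≈ (≈-sym l≈r))

  local≤-+lin : ∀ F c → Local _≤_ F → Local _≤_ (F +lin c)
  local≤-+lin = local-+lin (λ x≈y z≈w → ≤-respˡ x≈y ∘ ≤-respʳ z≈w) +-monoˡ-≤

  local≥-+lin : ∀ F c → Local (flip _≤_) F → Local (flip _≤_) (F +lin c)
  local≥-+lin = local-+lin (λ x≈y z≈w → ≤-respˡ z≈w ∘ ≤-respʳ x≈y) +-monoˡ-≤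

  pair? : ∀ F s σ τ → Dec (Pair _≤_ F s σ τ)
  pair? F s σ τ = Basis? σ ×-dec Basis? τ ×-dec (F σ + F τ ≤? s)

  -- The exchange axiom of valuated matroids at `i`, in the minimum convention.
  Exchangeable : (Subset n → Carrier) → Subset n → Subset n → Fin n → Set
  Exchangeable F σ τ i = ∃[ j ] τ ∋ j × σ ∌ j × Pair _≤_ F (F σ + F τ) (σ ⟨ i ↦ j ⟩) (τ ⟨ j ↦ i ⟩)

  -- The potential of Murota's proof that the three-term relations imply the
  -- exchange property: it is chosen such that a failure of the exchange of i
  -- between σ and τ makes τ ⟨ j ↦ i ⟩ worse than τ for every j.
  module Potential (F : Subset n → Carrier) (σ τ : Subset n) (i : Fin n)
                   (σ∋i : σ ∋ i) (τ∌i : τ ∌ i) (stuck : ¬ Exchangeable F σ τ i) where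

    -- The first finite case makes σ ⟨ i ↦ j ⟩ tie with σ; the second leaves
    -- τ ⟨ j ↦ i ⟩ worse than τ by 1.
    price : ∀ j → Bool → Dec (Basis (σ ⟨ i ↦ j ⟩)) → Dec (Basis (τ ⟨ j ↦ i ⟩)) → Carrier
    price j true  _       _       = 0#
    price j false (yes _) _       = F σ + - F (σ ⟨ i ↦ j ⟩)
    price j false (no _)  (yes _) = F (τ ⟨ j ↦ i ⟩) + - (F τ + 1#)
    price j false (no _)  (no _)  = 0#

    p : Vector Carrier n
    p j = price j (lookup σ j) (Basis? (σ ⟨ i ↦ j ⟩)) (Basis? (τ ⟨ j ↦ i ⟩))

    G : Subset n → Carrier
    G = F +lin p

    x-y+y≈x : ∀ x y → x + - y + y ≈ x
    x-y+y≈x x y = ≈-trans (+-assoc x (- y) y) (≈-trans (+-congˡ (-‿inverseˡ y)) (+-identityʳ x))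

    p[i]≈0 : p i ≈ 0#
    p[i]≈0 = go (lookup σ i) _ _ σ∋i
      where
      go : ∀ s d₁ d₂ → s ≡ inside → price i s d₁ d₂ ≈ 0#
      go true _ _ _ = ≈-refl

    p[j]-tight : ∀ {j} → σ ∌ j → Basis (σ ⟨ i ↦ j ⟩) → p j + F (σ ⟨ i ↦ j ⟩) ≈ F σ
    p[j]-tight {j} σ∌j bσ′ = go (lookup σ j) _ _ σ∌j
      where
      go : ∀ s d₁ d₂ → s ≡ outside → price j s d₁ d₂ + F (σ ⟨ i ↦ j ⟩) ≈ F σ
      go false (yes _)  _ _ = x-y+y≈x _ _
      go false (no ¬bσ′) _ _ = contradiction bσ′ ¬bσ′

    p[j]-loose : ∀ {j} → σ ∌ j → ¬ Basis (σ ⟨ i ↦ j ⟩) → Basis (τ ⟨ j ↦ i ⟩) →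
                 p j + (F τ + 1#) ≈ F (τ ⟨ j ↦ i ⟩)
    p[j]-loose {j} σ∌j ¬bσ′ bτ′ = go (lookup σ j) _ _ σ∌j
      where
      go : ∀ s d₁ d₂ → s ≡ outside → price j s d₁ d₂ + (F τ + 1#) ≈ F (τ ⟨ j ↦ i ⟩)
      go false (yes bσ′) _        _ = contradiction bσ′ ¬bσ′
      go false (no _)    (yes _)  _ = x-y+y≈x _ _
      go false (no _)    (no ¬bτ′) _ = contradiction bτ′ ¬bτ′

    G-tight : ∀ {j} → σ ∌ j → Basis (σ ⟨ i ↦ j ⟩) → G (σ ⟨ i ↦ j ⟩) ≈ G σ
    G-tight {j} σ∌j bσ′ = ≈-trans (≈-sym (≈-trans (+-congˡ p[i]≈0) (+-identityʳ _)))
      (≈-by (+-cong (lin-swap p σ σ∋i σ∌j) (p[j]-tight σ∌j bσ′))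
        (solve 6 (λ f′ l l′ pj f z → f′ :+ l′ :+ z :+ (l :+ pj :+ f) := f :+ l :+ (l′ :+ z :+ (pj :+ f′))) ≈-refl
          (F (σ ⟨ i ↦ j ⟩)) (lin p σ) (lin p (σ ⟨ i ↦ j ⟩)) (p j) (F σ) (p i)))

    F≤F+p : ∀ {j} → τ ∋ j → G (τ ⟨ j ↦ i ⟩) ≤ G τ → F (τ ⟨ j ↦ i ⟩) ≤ F τ + p j
    F≤F+p {j} τ∋j G≤G = ≤-respˡ (≈-trans (+-congˡ p[i]≈0) (+-identityʳ _))
      (≤-by (+-mono-≤ G≤G (≤-reflexive (≈-sym (lin-swap p τ τ∋j τ∌i))))
        (solve 6 (λ f′ l l′ pj f z → f′ :+ z :+ (f :+ l :+ (l′ :+ pj)) := f :+ pj :+ (f′ :+ l′ :+ (l :+ z))) ≈-refl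
          (F (τ ⟨ j ↦ i ⟩)) (lin p τ) (lin p (τ ⟨ j ↦ i ⟩)) (p j) (F τ) (p i)))

    -- If `σ ⟨ i ↦ j ⟩` is a basis, the price turns the assumed inequality into an exchange of `i`,
    -- contradicting `stuck`. If not, the price leaves a gap of `1#`, and the inequality becomes
    -- `1# ≤ 0#`.
    G-worse : ∀ {j} → τ ∋ j → σ ∌ j → Basis (τ ⟨ j ↦ i ⟩) → ¬ (G (τ ⟨ j ↦ i ⟩) ≤ G τ)
    G-worse {j} τ∋j σ∌j bτ′ G≤G = go (Basis? (σ ⟨ i ↦ j ⟩))
      where
      F≤ : F (τ ⟨ j ↦ i ⟩) ≤ F τ + p j
      F≤ = F≤F+p τ∋j G≤G
      go : ¬ Dec (Basis (σ ⟨ i ↦ j ⟩))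
      go (yes bσ′) = stuck (j , τ∋j , σ∌j , bσ′ , bτ′ , ≤-by (+-mono-≤ F≤ (≤-reflexive (p[j]-tight σ∌j bσ′)))
        (solve 5 (λ f g f′ g′ pj → f′ :+ g′ :+ (g :+ pj :+ f) := f :+ g :+ (g′ :+ (pj :+ f′))) ≈-refl
          (F σ) (F τ) (F (σ ⟨ i ↦ j ⟩)) (F (τ ⟨ j ↦ i ⟩)) (p j)))
      go (no ¬bσ′) = 1≰0 (≤-by (+-mono-≤ F≤ (≤-reflexive (p[j]-loose σ∌j ¬bσ′ bτ′)))
        (≈-trans (solve 4 (λ g g′ pj u → u :+ (g :+ pj :+ g′) := g′ :+ (pj :+ (g :+ u))) ≈-refl
          (F τ) (F (τ ⟨ j ↦ i ⟩)) (p j) 1#) (≈-sym (+-identityˡ _))))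

    module Step {k} (k≢i : k ≢ i) (σ∋k : σ ∋ k) (τ∌k : τ ∌ k) (local : Local _≤_ G) (bτ : Basis τ)
                {j} (τ∋j : τ ∋ j) (σ∌j : σ ∌ j)
                (minimal : ∀ l → τ ∋ l → σ ∌ l → Basis (τ ⟨ l ↦ k ⟩) → G (τ ⟨ j ↦ k ⟩) ≤ G (τ ⟨ l ↦ k ⟩)) where

      -- Stuckness passes from τ to τ ⟨ j ↦ k ⟩, which is closer to σ.
      G-stuck : ¬ Exchangeable G σ (τ ⟨ j ↦ k ⟩) i
      G-stuck (l , τ′∋l , σ∌l , bσ′ , bτ″ , le) =
        -- The tie at `σ ⟨ i ↦ l ⟩` shows that inserting `i` for `l` does not raise `G` at
        -- `τ ⟨ j ↦ k ⟩`. The relation around `τ` then makes `τ ⟨ j ↦ i ⟩` (by minimality of `j`) or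
        -- `τ ⟨ l ↦ i ⟩` no worse than `τ`, against `G-worse`.
        [ (λ (bl , bj , le′) → G-worse τ∋j σ∌j bj (cancel le′ (+-mono-≤ G″≤G′ (minimal l τ∋l σ∌l bl))))
        , (λ (bl , bj , le′) → G-worse τ∋l σ∌l bl (cancel′ le′ G″≤G′))
        ]′ (local-double {_∼_ = _≤_} {F = G} local τ τ∋j τ∋l τ∌k τ∌i j≢l k≢i bτ bτ″)
        where
        l≢k : l ≢ k
        l≢k = ∋×∌⇒≢ {σ = σ} σ∋k σ∌l ∘ ≡.sym
        j≢l : j ≢ l
        j≢l = ∋×∌⇒≢ {σ = τ ⟨ j ↦ k ⟩} τ′∋l (∌-⟨↦⟩ τ (∋×∌⇒≢ {σ = σ} σ∋k σ∌j ∘ ≡.sym)) ∘ ≡.sym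
        τ∋l : τ ∋ l
        τ∋l = ≡.trans (≡.sym (lookup-⟨↦⟩ τ (j≢l ∘ ≡.sym) l≢k)) τ′∋l
        cancel : ∀ {g g′ g″ gl gj} → gl + gj ≤ g + g″ → g″ + g′ ≤ g′ + gl → gj ≤ g
        cancel {g} {g′} {g″} {gl} {gj} p q = ≤-by (+-mono-≤ p q)
          (solve 5 (λ g g′ g″ gl gj → gj :+ (g :+ g″ :+ (g′ :+ gl)) := g :+ (gl :+ gj :+ (g″ :+ g′))) ≈-refl g g′ g″ gl gj)
        cancel′ : ∀ {g g′ g″ gl} → gl + g′ ≤ g + g″ → g″ ≤ g′ → gl ≤ g
        cancel′ {g} {g′} {g″} {gl} p q = ≤-by (+-mono-≤ p q)
          (solve 4 (λ g g′ g″ gl → gl :+ (g :+ g″ :+ g′) := g :+ (gl :+ g′ :+ g″)) ≈-refl g g′ g″ gl)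
        G″≤G′ : G (τ ⟨ j ↦ k ⟩ ⟨ l ↦ i ⟩) ≤ G (τ ⟨ j ↦ k ⟩)
        G″≤G′ = cancel′ (≤-respˡ (+-comm _ _) (≤-respʳ (+-comm _ _) le)) (≤-reflexive (≈-sym (G-tight σ∌l bσ′)))

  -- Induction on `τ` minus `σ`. If `i` is the only element of `σ` outside `τ`, the matroid exchange
  -- interchanges `σ` and `τ` and the sums agree. Otherwise a failure at `τ` is carried by `G` to a
  -- basis closer to `σ` that still lacks `i`, where the induction hypothesis for `G` refutes it.
  valuated-exchange : ∀ F → Local _≤_ F → ∀ σ τ → Acc _⊂_ (τ ∩ ∁ σ) → Basis σ → Basis τ →
                      ∀ {i} → σ ∋ i → τ ∌ i → Exchangeable F σ τ i
  valuated-exchange F local σ τ (acc rec) bσ bτ {i} σ∋i τ∌i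
    with any? (λ j → τ ∋? j ×-dec σ ∌? j ×-dec pair? F (F σ + F τ) (σ ⟨ i ↦ j ⟩) (τ ⟨ j ↦ i ⟩))
       | any? (λ k → σ ∋? k ×-dec τ ∌? k ×-dec ¬? (k ≟ i))
  ... | yes exchangeable | _ = exchangeable
  ... | no stuck | no only-i with exchange′ bσ bτ σ∋i τ∌i
  ...   | j , τ∋j , σ∌j , bσ′ = j , τ∋j , σ∌j , bσ′ , subst Basis (≡.sym τ′≡σ) bσ ,
            ≤-reflexive (≈-trans (+-comm _ _) (reflexive (cong₂ (λ ρ π → F ρ + F π) τ′≡σ σ′≡τ)))
    where
    sub : ∀ x → σ ⟨ i ↦ j ⟩ ∋ x → τ ∋ x
    sub x σ′∋x with x ≟ i | x ≟ j
    ... | yes refl | _        = contradiction σ′∋x (∌⇒¬∋ {σ = σ ⟨ i ↦ j ⟩} (∌-⟨↦⟩ σ (∋×∌⇒≢ {σ = σ} σ∋i σ∌j)))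
    ... | no  _    | yes refl = τ∋j
    ... | no  x≢i  | no  x≢j  with τ ∋? x
    ...   | yes τ∋x = τ∋x
    ...   | no  τ∌x = contradiction
              (x , ≡.trans (≡.sym (lookup-⟨↦⟩ σ x≢i x≢j)) σ′∋x , ¬∋⇒∌ {σ = τ} τ∌x , x≢i) only-i
    σ′≡τ : σ ⟨ i ↦ j ⟩ ≡ τ
    σ′≡τ = basis-⊆⇒≡ bσ′ bτ sub
    τ′≡σ : τ ⟨ j ↦ i ⟩ ≡ σ
    τ′≡σ = ≡.trans (cong _⟨ j ↦ i ⟩ (≡.sym σ′≡τ)) (⟨↦⟩-inverse σ σ∋i σ∌j)
  valuated-exchange F local σ τ (acc rec) bσ bτ {i} σ∋i τ∌i
      | no stuck | yes (i′ , σ∋i′ , τ∌i′ , i′≢i)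
      with exchange-avoiding bσ bτ σ∋i τ∌i σ∋i′ τ∌i′ i′≢i
  ... | k , j₀ , σ∋k , τ∌k , k≢i , τ∋j₀ , σ∌j₀ , bj₀
      with minimiser (allFin n)
             (λ j → τ ∋? j ×-dec σ ∌? j ×-dec Basis? (τ ⟨ j ↦ k ⟩))
             (λ j → Potential.G F σ τ i σ∋i τ∌i stuck (τ ⟨ j ↦ k ⟩))
             (j₀ , τ∋j₀ , σ∌j₀ , bj₀)
  ... | j , (τ∋j , σ∌j , bτ′) , minimal =
      contradiction
        (valuated-exchange G (local≤-+lin F p local) σ (τ ⟨ j ↦ k ⟩) (rec (⟨↦⟩-∖-⊂ σ τ σ∋k τ∋j σ∌j)) bσ bτ′ σ∋i
          (≡.trans (lookup-⟨↦⟩ τ (∋×∌⇒≢ {σ = σ} σ∋i σ∌j) (k≢i ∘ ≡.sym)) τ∌i))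
        (Step.G-stuck k≢i σ∋k τ∌k (local≤-+lin F p local) bτ τ∋j σ∌j
          (λ l τ∋l σ∌l bl → minimal l (∈-allFin l) (τ∋l , σ∌l , bl)))
      where open Potential F σ τ i σ∋i τ∌i stuck

-- Functions that are valuations together with their negatives are affine.

module AffineValuations (ℝ : RealField) {n d} (M : Matroid n d) where
  open RealField ℝ hiding (zero; _-_) renaming (refl to ≈-refl; sym to ≈-sym; trans to ≈-trans)
  open Reals ℝ
  open Matroid M
  open ValuatedExchange ℝ M

  -- If the bounds from below and from above come from different terms, the relation for `_≤_` is
  -- read once more from the smaller term. One of the two larger terms is then at most that one, and
  -- the chain of inequalities closes.
  local-≈ : ∀ F → Local _≤_ F → Local (flip _≤_) F → Local _≈_ F
  local-≈ F local≤ local≥ S {a} {b} {c} {e} q bab bce with local≤ S q bab bce | local≥ S q bab bce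
  ... | inj₁ (bac , bbe , le) | inj₁ (_ , _ , ge) = inj₁ (bac , bbe , ≤-antisym le ge)
  ... | inj₂ (bae , bbc , le) | inj₂ (_ , _ , ge) = inj₂ (bae , bbc , ≤-antisym le ge)
  ... | inj₁ (bac , bbe , le) | inj₂ (bae , bbc , ge) with local≤ S (swap₂₃ q) bac bbe
  ...   | inj₁ (_ , _ , le′) = inj₁ (bac , bbe , ≤-antisym le le′)
  ...   | inj₂ (_ , _ , le′) rewrite ⟪⟫-sym S c b = inj₁ (bac , bbe , ≤-antisym le (≤-trans ge le′))
  local-≈ F local≤ local≥ S {a} {b} {c} {e} q bab bce
      | inj₂ (bae , bbc , le) | inj₁ (bac , bbe , ge) with local≤ S (swap₂₃ (swap₃₄ q)) bae bbc
  ...   | inj₁ (_ , _ , le′) rewrite ⟪⟫-sym S e c = inj₂ (bae , bbc , ≤-antisym le le′)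
  ...   | inj₂ (_ , _ , le′) rewrite ⟪⟫-sym S e b = inj₂ (bae , bbc , ≤-antisym le (≤-trans ge le′))

  module Walks (G : Subset n → Carrier) (local : Local _≈_ G) (κ : Carrier) where

    Tight : Subset n → Rel (Fin n) 0ℓ
    Tight σ i j = σ ∋ i × σ ∌ j × Basis (σ ⟨ i ↦ j ⟩) × G (σ ⟨ i ↦ j ⟩) ≈ κ

    -- Walks in the bipartite exchange graph of σ, of length 2m + 1.
    data Walk (σ : Subset n) : ℕ → Rel (Fin n) 0ℓ where
      edge : ∀ {i j} → Tight σ i j → Walk σ 0 i j
      step : ∀ {m i j k l} → Tight σ i j → Tight σ k j → Walk σ m k l → Walk σ (ℕ.suc m) i l

    last-∌ : ∀ {σ m i j} → Walk σ m i j → σ ∌ j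
    last-∌ (edge (_ , σ∌j , _)) = σ∌j
    last-∌ (step _ _ w)         = last-∌ w

    -- The cycle condition of the exchange graph. It ranges over all `σ` of value `κ` because
    -- pivoting changes the basis, and over all lengths up to `m` because chords shorten walks by an
    -- unknown amount.
    Closes : ℕ → Set
    Closes m = ∀ {k} → k ℕ.≤ m → ∀ {σ i j} → Basis σ → G σ ≈ κ → Walk σ k i j →
               Basis (σ ⟨ i ↦ j ⟩) → G (σ ⟨ i ↦ j ⟩) ≈ κ

    +-cancel-κ : ∀ {x y s t} → x + y ≈ s + t → y ≈ κ → s ≈ κ → t ≈ κ → x ≈ κ
    +-cancel-κ {x} {y} {s} {t} eq y≈κ s≈κ t≈κ =
      ≈-by (+-cong eq (+-cong (≈-sym y≈κ) (+-cong s≈κ t≈κ)))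
        (solve 5 (λ x y s t k → x :+ (s :+ t :+ (y :+ (k :+ k))) := k :+ (x :+ y :+ (k :+ (s :+ t)))) ≈-refl
          x y s t κ)

    module Pivot {m} (closes : Closes m) {σ i j} (bσ : Basis σ) (Gσ≈κ : G σ ≈ κ) (ij : Tight σ i j) where
      private
        σ′ = σ ⟨ i ↦ j ⟩
        σ∋i = proj₁ ij
        σ∌j = proj₁ (proj₂ ij)
        bσ′ = proj₁ (proj₂ (proj₂ ij))
        Gσ′≈κ = proj₂ (proj₂ (proj₂ ij))

      -- In the relation between the edges `i j` and `a b`, one case is a double exchange of value
      -- `κ`, so that `a b` stays tight after the pivot. In the other, both chords `i b` and `a j`
      -- are present; `a j` closes the walk `w` and is tight, hence so is `i b`.
      move : ∀ {r a b} → r ℕ.≤ m → Walk σ r a j → Tight σ a b → Tight σ i b ⊎ Tight σ′ a b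
      move {r} {a} {b} r≤m w ab@(σ∋a , σ∌b , bab , Gab≈κ) with i ≟ a | j ≟ b
      ... | yes refl | _        = inj₁ ab
      ... | no  _    | yes refl = inj₁ ij
      ... | no  i≢a  | no  j≢b  with local-cross {_∼_ = _≈_} {F = G} local σ σ∋i σ∋a σ∌j σ∌b i≢a j≢b bσ′ bab
      ...   | inj₁ (_ , bσ″ , eq) = inj₂
                ( ≡.trans (lookup-⟨↦⟩ σ (i≢a ∘ ≡.sym) (∋×∌⇒≢ {σ = σ} σ∋a σ∌j)) σ∋a
                , ≡.trans (lookup-⟨↦⟩ σ (∋×∌⇒≢ {σ = σ} σ∋i σ∌b ∘ ≡.sym) (j≢b ∘ ≡.sym)) σ∌b
                , bσ″ , +-cancel-κ (≈-trans (+-comm _ _) eq) Gσ≈κ Gσ′≈κ Gab≈κ)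
      ...   | inj₂ (bib , baj , eq) = inj₁
                (σ∋i , σ∌b , bib , +-cancel-κ eq (closes r≤m bσ Gσ≈κ w baj) Gσ′≈κ Gab≈κ)

      -- Either the walk survives the pivot, or a chord from i shortcuts it.
      transport : ∀ {r s a b} → r ℕ.+ s ℕ.≤ m → Walk σ r a j → Walk σ s a b →
                  (∃[ k ] k ℕ.≤ m × Walk σ k i b) ⊎ Walk σ′ s a b
      transport {r} r+s≤m back (edge ab) with move (ℕ.≤-trans (ℕ.m≤m+n r 0) r+s≤m) back ab
      ... | inj₁ ib  = inj₁ (0 , ℕ.z≤n , edge ib)
      ... | inj₂ ab′ = inj₂ (edge ab′)
      transport {r} {ℕ.suc s} r+s≤m back (step ab cb w)
        with move (ℕ.≤-trans (ℕ.m≤m+n r _) r+s≤m) back ab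
      ... | inj₁ ib  = inj₁ (ℕ.suc s , ℕ.≤-trans (ℕ.m≤n+m _ r) r+s≤m , step ib cb w)
      ... | inj₂ ab′
        -- `back` returns to `j` along the edges already traversed: its index grows by one as that
        -- of the remaining walk drops by one, so both stay in the range of `closes`.
        with r+s<m ← ℕ.≤-trans (ℕ.≤-reflexive (≡.sym (ℕ.+-suc r s))) r+s≤m
        with move (ℕ.≤-trans (ℕ.m≤m+n (ℕ.suc r) s) r+s<m) (step cb ab back) cb
      ...   | inj₁ ib  = inj₁ (ℕ.suc s , ℕ.≤-trans (ℕ.m≤n+m _ r) r+s≤m , step ib cb w)
      ...   | inj₂ cb′ = Sum.map₂ (step ab′ cb′) (transport r+s<m (step cb ab back) w)

    -- Pivoting on the first edge gives a shorter walk with the same ends or keeps the rest of the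
    -- walk tight at the pivoted basis. In the latter case the relation between the chord `i j` and
    -- the edge `a j₁` leaves one unknown value, that of the chord `a j` at `σ` or at the pivoted
    -- basis; `w` or its transport closes there.
    closes : ∀ m → Closes m
    closes m       ℕ.z≤n       bσ Gσ≈κ (edge (_ , _ , _ , eq)) _ = eq
    closes (ℕ.suc m) (ℕ.s≤s k≤m) {σ} {i} {j} bσ Gσ≈κ (step {j = j₁} {k = a} ij₁ aj₁ w) bij
      with i ≟ a | j ≟ j₁
    ... | yes refl | _        = closes m k≤m bσ Gσ≈κ w bij
    ... | no  _    | yes refl = proj₂ (proj₂ (proj₂ ij₁))
    ... | no  i≢a  | no  j≢j₁ with Pivot.transport (closes m) bσ Gσ≈κ ij₁ k≤m (edge aj₁) w
    ...   | inj₁ (k , k≤m , w′) = closes m k≤m bσ Gσ≈κ w′ bij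
    ...   | inj₂ w′ with local-cross {_∼_ = _≈_} {F = G} local σ (proj₁ ij₁) (proj₁ aj₁) (last-∌ w) (proj₁ (proj₂ ij₁))
                          i≢a j≢j₁ bij (proj₁ (proj₂ (proj₂ aj₁)))
    ...     | inj₂ (_ , baj , eq) =
                +-cancel-κ (≈-sym eq) (proj₂ (proj₂ (proj₂ aj₁))) (proj₂ (proj₂ (proj₂ ij₁)))
                  (closes m k≤m bσ Gσ≈κ w baj)
    ...     | inj₁ (_ , bσ″ , eq) rewrite ⟨↦⟩-cross σ (proj₁ ij₁) (proj₁ aj₁) i≢a (last-∌ w) (proj₁ (proj₂ ij₁)) =
                +-cancel-κ (≈-sym eq) (proj₂ (proj₂ (proj₂ aj₁))) Gσ≈κ
                  (closes m k≤m (proj₁ (proj₂ (proj₂ ij₁))) (proj₂ (proj₂ (proj₂ ij₁))) w′ bσ″)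

    -- Edges lead from `σ` to its complement, so forward and backward edges must alternate.
    Star⇒Walk : ∀ {σ i j} → EqClosure (Tight σ) i j → σ ∋ i → σ ∌ j → ∃[ m ] Walk σ m i j
    Star⇒Walk {σ} ε σ∋i σ∌i = contradiction σ∋i (∌⇒¬∋ {σ = σ} σ∌i)
    Star⇒Walk {σ} (bwd (_ , σ∌i , _) ◅ _) σ∋i _ = contradiction σ∋i (∌⇒¬∋ {σ = σ} σ∌i)
    Star⇒Walk (fwd ij ◅ ε) _ _ = 0 , edge ij
    Star⇒Walk {σ} (fwd (_ , σ∌j , _) ◅ fwd (σ∋j , _) ◅ _) _ _ = contradiction σ∋j (∌⇒¬∋ {σ = σ} σ∌j)
    Star⇒Walk (fwd ij ◅ bwd kj ◅ rest) _ σ∌l with Star⇒Walk rest (proj₁ kj) σ∌l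
    ... | m , w = ℕ.suc m , step ij kj w

  -- Exchange between `τ` and `σ` brings `τ` closer to `σ` and `σ` to a neighbour. The neighbour is
  -- no smaller than `σ`, so the new `τ` is no larger than the old one.
  local-min⇒min : ∀ G → Local _≤_ G → ∀ {σ} → Basis σ →
                  (∀ {i j} → σ ∋ i → σ ∌ j → Basis (σ ⟨ i ↦ j ⟩) → G σ ≤ G (σ ⟨ i ↦ j ⟩)) →
                  ∀ τ → Acc _⊂_ (τ ∩ ∁ σ) → Basis τ → G σ ≤ G τ
  local-min⇒min G local {σ} bσ min τ (acc rec) bτ with any? (λ j → τ ∋? j ×-dec σ ∌? j)
  ... | no ¬j = ≤-reflexive (reflexive (cong G (≡.sym (basis-⊆⇒≡ bτ bσ sub))))
    where
    sub : ∀ x → τ ∋ x → σ ∋ x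
    sub x τ∋x with σ ∋? x
    ... | yes σ∋x = σ∋x
    ... | no  σ∌x = contradiction (x , τ∋x , ¬∋⇒∌ {σ = σ} σ∌x) ¬j
  ... | yes (j , τ∋j , σ∌j)
      with valuated-exchange G local τ σ (⊂-wellFounded _) bτ bσ τ∋j σ∌j
  ...   | i , σ∋i , τ∌i , bτ′ , bσ′ , le = ≤-trans
            (local-min⇒min G local bσ min (τ ⟨ j ↦ i ⟩) (rec (⟨↦⟩-∖-⊂ σ τ σ∋i τ∋j σ∌j)) bτ′)
            (≤-by (+-mono-≤ le (min σ∋i σ∌j bσ′))
              (solve 4 (λ s t s′ t′ → t′ :+ (t :+ s :+ s′) := t :+ (t′ :+ s′ :+ s)) ≈-refl
                (G σ) (G τ) (G (σ ⟨ i ↦ j ⟩)) (G (τ ⟨ j ↦ i ⟩))))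

  local-neg : ∀ G → Local (flip _≤_) G → Local _≤_ (λ σ → - G σ)
  local-neg G local S q bσ bτ = Sum.map negate negate (local S q bσ bτ)
    where
    negate : ∀ {σ τ s t} → Pair (flip _≤_) G (s + t) σ τ → Pair _≤_ (λ σ → - G σ) (- s + - t) σ τ
    negate (bσ , bτ , le) = bσ , bτ , neg₂-anti-≤ le

  local-neg⁻¹ : ∀ G → Local _≤_ (λ σ → - G σ) → Local (flip _≤_) G
  local-neg⁻¹ G local S q bσ bτ = Sum.map negate negate (local S q bσ bτ)
    where
    negate : ∀ {σ τ s t} → Pair _≤_ (λ σ → - G σ) (- s + - t) σ τ → Pair (flip _≤_) G (s + t) σ τ
    negate (bσ , bτ , le) = bσ , bτ , neg₂-anti-≤⁻¹ le

  affine : ∀ F → Local _≤_ F → Local (flip _≤_) F →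
           ∃[ k ] ∃[ c ] (∀ σ → Basis σ → F σ ≈ k + lin c σ)
  -- The coefficients are those of the negated potential, since `F +lin p` is constant on the bases.
  affine F local≤ local≥ = G β , (λ t → - 1# * p t) , F≈
    where
    β : Subset n
    β = proj₁ nonempty
    bβ : Basis β
    bβ = proj₂ nonempty

    Edge : Rel (Fin n) 0ℓ
    Edge i j = β ∋ i × β ∌ j × Basis (β ⟨ i ↦ j ⟩)

    open Potentials Edge (λ i j → β ∋? i ×-dec β ∌? j ×-dec Basis? (β ⟨ i ↦ j ⟩))
                    (λ i j → F (β ⟨ i ↦ j ⟩)) (F β)

    tight : ∀ p {i j} → β ∋ i → β ∌ j → Balanced p i j → (F +lin p) (β ⟨ i ↦ j ⟩) ≈ (F +lin p) β
    tight p {i} {j} β∋i β∌j balanced = ≈-by (+-cong balanced (lin-swap p β β∋i β∌j))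
      (solve 6 (λ f f′ l l′ pi pj → f′ :+ l′ :+ (f :+ pi :+ (l :+ pj)) := f :+ l :+ (f′ :+ pj :+ (l′ :+ pi))) ≈-refl
        (F β) (F (β ⟨ i ↦ j ⟩)) (lin p β) (lin p (β ⟨ i ↦ j ⟩)) (p i) (p j))

    balance : ∀ p {i j} → β ∋ i → β ∌ j → (F +lin p) (β ⟨ i ↦ j ⟩) ≈ (F +lin p) β → Balanced p i j
    balance p {i} {j} β∋i β∌j tight = ≈-by (+-cong tight (≈-sym (lin-swap p β β∋i β∌j)))
      (solve 6 (λ f f′ l l′ pi pj → f′ :+ pj :+ (f :+ l :+ (l′ :+ pi)) := f :+ pi :+ (f′ :+ l′ :+ (l :+ pj))) ≈-refl
        (F β) (F (β ⟨ i ↦ j ⟩)) (lin p β) (lin p (β ⟨ i ↦ j ⟩)) (p i) (p j))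

    -- Balanced edges for `p` are the tight edges of `F +lin p` at `β`, so this is the closing of
    -- walks in the exchange graph.
    closed : ∀ p {i j} → EqClosure (BalancedEdge p) i j → Edge i j → Balanced p i j
    closed p {i} {j} path (β∋i , β∌j , bij) = balance p β∋i β∌j
      (closes _ ℕ.≤-refl bβ ≈-refl (proj₂ (Star⇒Walk tightPath β∋i β∌j)) bij)
      where
      open Walks (F +lin p) (local-≈ (F +lin p) (local≤-+lin F p local≤) (local≥-+lin F p local≥)) ((F +lin p) β)
      tightPath : EqClosure (Tight β) i j
      tightPath = EqClosure.map
        (λ ((β∋x , β∌y , bxy) , balanced) → β∋x , β∌y , bxy , tight p β∋x β∌y balanced) path

    p : Vector Carrier n
    p = proj₁ (potential closed)

    G : Subset n → Carrier
    G = F +lin p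

    neighbour : ∀ {i j} → β ∋ i → β ∌ j → Basis (β ⟨ i ↦ j ⟩) → G (β ⟨ i ↦ j ⟩) ≈ G β
    neighbour β∋i β∌j bij = tight p β∋i β∌j (proj₂ (potential closed) (β∋i , β∌j , bij))

    G≈ : ∀ σ → Basis σ → G σ ≈ G β
    G≈ σ bσ = ≤-antisym
      (≤-by (local-min⇒min (λ τ → - G τ) (local-neg G (local≥-+lin F p local≥)) bβ
               (λ i j b → ≤-reflexive (-‿cong (≈-sym (neighbour i j b)))) σ (⊂-wellFounded _) bσ)
        (≈-trans (-‿inverseʳ (G σ)) (≈-sym (-‿inverseʳ (G β)))))
      (local-min⇒min G (local≤-+lin F p local≤) bβ
        (λ i j b → ≤-reflexive (≈-sym (neighbour i j b))) σ (⊂-wellFounded _) bσ)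

    F≈ : ∀ σ → Basis σ → F σ ≈ G β + lin (λ t → - 1# * p t) σ
    F≈ σ bσ = begin
      F σ                              ≈⟨ ≈-sym (x+z-z≈x (F σ) (lin p σ)) ⟩
      G σ + - lin p σ                  ≈⟨ +-cong (G≈ σ bσ) (≈-sym (ℝ-Ring.-1*x≈-x (lin p σ))) ⟩
      G β + - 1# * lin p σ             ≈⟨ +-congˡ (≈-sym (lin-* (- 1#) p σ)) ⟩
      G β + lin (λ t → - 1# * p t) σ   ∎
      where open SetoidReasoning setoid

-- The Dressian in terms of three-term inequalities.

module Dressians (ℝ : RealField) {n d} (M : Matroid n d) where
  open RealField ℝ hiding (zero; _-_) renaming (refl to ≈-refl; sym to ≈-sym; trans to ≈-trans)
  open Reals ℝ
  open Matroid M
  open ValuatedExchange ℝ M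
  open AffineValuations ℝ M
  open Valuations ℝ
  open SupEquality _≈_ using (_≈⁺_; ≈⁺-sym)
  open SupOrder _≤_ using (_≤⁺_; [_]; _≤⊤⁺; ≤⁺-trans; ≤⁺-antisym; ≤⁺-reflexive)

  -- The value `0#` off the bases is a placeholder: `Local` and `Min` read a function at bases only.
  total : ℝ^ M → Subset n → Carrier
  total v σ with Basis? σ
  ... | yes b = v σ b
  ... | no  _ = 0#

  total-basis : ∀ v σ (b : Basis σ) → total v σ ≡ v σ b
  total-basis v σ b with Basis? σ
  ... | yes _  = refl
  ... | no  ¬b = contradiction b ¬b

  private
    ext : ℝ^ M → Subset n → Carrier ⁺
    ext = extend M

  ext-basis : ∀ v σ → Basis σ → ext v σ ≡ [ total v σ ]
  ext-basis v σ b with Basis? σ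
  ... | yes _  = refl
  ... | no  ¬b = contradiction b ¬b

  ext-+-finite : ∀ v σ τ {s} → ext v σ +⁺ ext v τ ≤⁺ [ s ] → Pair _≤_ (total v) s σ τ
  ext-+-finite v σ τ le with Basis? σ | Basis? τ | le
  ... | yes bσ | yes bτ | [ le′ ] = bσ , bτ , le′

  minAttainedTwice⇒ : ∀ {x y z} → MinAttainedTwice x y z → (y ≤⁺ x) ⊎ (z ≤⁺ x)
  minAttainedTwice⇒ (inj₁ (x≈y , _))        = inj₁ (≤⁺-reflexive ≤-reflexive (≈⁺-sym ≈-sym x≈y))
  minAttainedTwice⇒ (inj₂ (inj₁ (x≈z , _))) = inj₂ (≤⁺-reflexive ≤-reflexive (≈⁺-sym ≈-sym x≈z))
  minAttainedTwice⇒ (inj₂ (inj₂ (_ , y≤x))) = inj₁ y≤x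

  -- Passing from each value to one that is at most as large ends in a cycle. Its members are equal,
  -- and a value off the cycle lies above them.
  minAttainedTwice⇐ : ∀ {x y z} → (y ≤⁺ x) ⊎ (z ≤⁺ x) → (x ≤⁺ y) ⊎ (z ≤⁺ y) → (x ≤⁺ z) ⊎ (y ≤⁺ z) →
                      MinAttainedTwice x y z
  minAttainedTwice⇐ = go
    where
    antisym⁺ : ∀ {x y} → x ≤⁺ y → y ≤⁺ x → x ≈⁺ y
    antisym⁺ = ≤⁺-antisym ≤-antisym
    trans⁺ : ∀ {x y z} → x ≤⁺ y → y ≤⁺ z → x ≤⁺ z
    trans⁺ = ≤⁺-trans ≤-trans
    go : ∀ {x y z} → (y ≤⁺ x) ⊎ (z ≤⁺ x) → (x ≤⁺ y) ⊎ (z ≤⁺ y) → (x ≤⁺ z) ⊎ (y ≤⁺ z) →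
         MinAttainedTwice x y z
    go (inj₁ y≤x) (inj₁ x≤y) (inj₁ x≤z) = inj₁ (antisym⁺ x≤y y≤x , x≤z)
    go (inj₁ y≤x) (inj₁ x≤y) (inj₂ y≤z) = inj₁ (antisym⁺ x≤y y≤x , trans⁺ x≤y y≤z)
    go (inj₁ y≤x) (inj₂ z≤y) (inj₁ x≤z) = inj₂ (inj₂ (antisym⁺ (trans⁺ y≤x x≤z) z≤y , y≤x))
    go (inj₁ y≤x) (inj₂ z≤y) (inj₂ y≤z) = inj₂ (inj₂ (antisym⁺ y≤z z≤y , y≤x))
    go (inj₂ z≤x) (inj₁ x≤y) (inj₁ x≤z) = inj₂ (inj₁ (antisym⁺ x≤z z≤x , x≤y))
    go (inj₂ z≤x) (inj₁ x≤y) (inj₂ y≤z) = inj₂ (inj₁ (antisym⁺ (trans⁺ x≤y y≤z) z≤x , x≤y))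
    go (inj₂ z≤x) (inj₂ z≤y) (inj₁ x≤z) = inj₂ (inj₁ (antisym⁺ x≤z z≤x , trans⁺ x≤z z≤y))
    go (inj₂ z≤x) (inj₂ z≤y) (inj₂ y≤z) = inj₂ (inj₂ (antisym⁺ y≤z z≤y , trans⁺ y≤z z≤x))

  dressian⇒local : ∀ v → Dressian M v → Local _≤_ (total v)
  dressian⇒local v dr S {a} {b} {c} {e} q bab bce
    with dr S (≡.trans (≡.sym (∣⟪⟫∣ {S = S} ∌₁ ∌₂ ≢₁₂)) (rank bab)) a b c e
            (∌⇒∉ ∌₁) (∌⇒∉ ∌₂) (∌⇒∉ ∌₃) (∌⇒∉ ∌₄) ≢₁₂ ≢₁₃ ≢₁₄ ≢₂₃ ≢₂₄ ≢₃₄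
    where open Quad q
  ... | min rewrite ∪-⟪⟫ S a b | ∪-⟪⟫ S c e | ∪-⟪⟫ S a c | ∪-⟪⟫ S b e | ∪-⟪⟫ S a e | ∪-⟪⟫ S b c
                  | ext-basis v (S ⟪ a , b ⟫) bab | ext-basis v (S ⟪ c , e ⟫) bce =
    Sum.map (ext-+-finite v _ _) (ext-+-finite v _ _) (minAttainedTwice⇒ min)

  local⇒dressian : ∀ v → Local _≤_ (total v) → Dressian M v
  local⇒dressian v local S size i j k l i∉S j∉S k∉S l∉S i≢j i≢k i≢l j≢k j≢l k≢l
    rewrite ∪-⟪⟫ S i j | ∪-⟪⟫ S k l | ∪-⟪⟫ S i k | ∪-⟪⟫ S j l | ∪-⟪⟫ S i l | ∪-⟪⟫ S j k =
    minAttainedTwice⇐ (bound q)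
      (Sum.map₂ (reorder (S ⟪ i , l ⟫) k j) (bound (swap₂₃ q)))
      (Sum.map (reorder (S ⟪ i , j ⟫) l k) (reorder (S ⟪ i , k ⟫) l j) (bound (swap₂₃ (swap₃₄ q))))
    where
    reorder : ∀ σ a b {s} → ext v σ +⁺ ext v (S ⟪ a , b ⟫) ≤⁺ s → ext v σ +⁺ ext v (S ⟪ b , a ⟫) ≤⁺ s
    reorder σ a b {s} = subst (λ τ → ext v σ +⁺ ext v τ ≤⁺ s) (⟪⟫-sym S a b)
    q : Quad S i j k l
    q = quad (∉⇒∌ i∉S) (∉⇒∌ j∉S) (∉⇒∌ k∉S) (∉⇒∌ l∉S) i≢j i≢k i≢l j≢k j≢l k≢l
    finite : ∀ {σ τ s} → Pair _≤_ (total v) s σ τ → ext v σ +⁺ ext v τ ≤⁺ [ s ]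
    finite {σ} {τ} (bσ , bτ , le) rewrite ext-basis v σ bσ | ext-basis v τ bτ = [ le ]
    bound : ∀ {a b c e} → Quad S a b c e →
            (ext v (S ⟪ a , c ⟫) +⁺ ext v (S ⟪ b , e ⟫) ≤⁺ ext v (S ⟪ a , b ⟫) +⁺ ext v (S ⟪ c , e ⟫)) ⊎
            (ext v (S ⟪ a , e ⟫) +⁺ ext v (S ⟪ b , c ⟫) ≤⁺ ext v (S ⟪ a , b ⟫) +⁺ ext v (S ⟪ c , e ⟫))
    bound {a} {b} {c} {e} q = go (S ⟪ a , b ⟫) (S ⟪ c , e ⟫) (local S q)
      where
      go : ∀ {σ₁ σ₂ τ₁ τ₂} σ τ →
           (Basis σ → Basis τ → let s = total v σ + total v τ in
             Pair _≤_ (total v) s σ₁ τ₁ ⊎ Pair _≤_ (total v) s σ₂ τ₂) →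
           (ext v σ₁ +⁺ ext v τ₁ ≤⁺ ext v σ +⁺ ext v τ) ⊎ (ext v σ₂ +⁺ ext v τ₂ ≤⁺ ext v σ +⁺ ext v τ)
      go σ τ pairs with Basis? σ | Basis? τ
      ... | yes bσ | yes bτ = Sum.map finite finite (pairs bσ bτ)
      ... | yes _  | no _   = inj₁ (_ ≤⊤⁺)
      ... | no _   | _      = inj₁ (_ ≤⊤⁺)

  local-resp : ∀ {F G} → (∀ σ → Basis σ → F σ ≈ G σ) → Local _≤_ F → Local _≤_ G
  local-resp {F} {G} F≈G local S q bσ bτ = Sum.map (pair s≈t) (pair s≈t) (local S q bσ bτ)
    where
    s≈t = +-cong (F≈G _ bσ) (F≈G _ bτ)
    pair : ∀ {σ τ s t} → s ≈ t → Pair _≤_ F s σ τ → Pair _≤_ G t σ τ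
    pair s≈t (b₁ , b₂ , le) = b₁ , b₂ , ≤-respˡ (+-cong (F≈G _ b₁) (F≈G _ b₂)) (≤-respʳ s≈t le)

  -- Exchange only yields one of the two bases of a term; the second comes from
  -- exchanging another of the four elements.
  local-0 : Local _≤_ (λ _ → 0#)
  local-0 S {a} {b} {c} {e} q bab bce
    with pair-exchange q bab bce
       | pair-exchange (swap₁₂ q) (subst Basis (⟪⟫-sym S a b) bab) bce
       | pair-exchange (swap-pairs q) bce bab
       | pair-exchange (swap₁₂ (swap-pairs q)) (subst Basis (⟪⟫-sym S c e) bce) bab
  ... | inj₁ bc | inj₁ ac | inj₁ ea | _       = inj₂ (subst Basis (⟪⟫-sym S e a) ea , bc , ≤-refl)
  ... | inj₁ bc | inj₁ ac | inj₂ eb | _       = inj₁ (ac , subst Basis (⟪⟫-sym S e b) eb , ≤-refl)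
  ... | inj₁ bc | inj₂ ae | _       | _       = inj₂ (ae , bc , ≤-refl)
  ... | inj₂ be | inj₁ ac | _       | _       = inj₁ (ac , be , ≤-refl)
  ... | inj₂ be | inj₂ ae | _       | inj₁ ca = inj₁ (subst Basis (⟪⟫-sym S c a) ca , be , ≤-refl)
  ... | inj₂ be | inj₂ ae | _       | inj₂ cb = inj₂ (ae , subst Basis (⟪⟫-sym S c b) cb , ≤-refl)

  -- The lineality space.

  LinearForm : Pred (ℝ^ M) 0ℓ
  LinearForm u = ∃[ c ] (∀ σ (b : Basis σ) → u σ b ≈ lin c σ)

  linearForm-isSubspace : IsSubspace M LinearForm
  linearForm-isSubspace = record
    { resp     = λ u≈w (c , u≈) → c , λ σ b → ≈-trans (≈-sym (u≈w σ b)) (u≈ σ b)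
    -- The zero coefficients are written as a product so that `lin-*` applies to them.
    ; 0-closed = (λ _ → 0# * 0#) , λ σ _ → ≈-sym (≈-trans (lin-* 0# (λ _ → 0#) σ) (zeroˡ _))
    ; +-closed = λ (c , u≈) (c′ , w≈) → (λ t → c t + c′ t) ,
                   λ σ b → ≈-trans (+-cong (u≈ σ b) (w≈ σ b)) (≈-sym (lin-+ c c′ σ))
    ; *-closed = λ a (c , u≈) → (λ t → a * c t) ,
                   λ σ b → ≈-trans (*-congˡ (u≈ σ b)) (≈-sym (lin-* a c σ))
    }

  linearForm-translates : TranslatesDressian M LinearForm
  linearForm-translates w u dr (c , u≈) = local⇒dressian (_+ᵛ_ M w u)
    (local-resp eq (local≤-+lin (total w) c (dressian⇒local w dr)))
    where
    eq : ∀ σ → Basis σ → total w σ + lin c σ ≈ total (_+ᵛ_ M w u) σ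
    eq σ b rewrite total-basis w σ b | total-basis (_+ᵛ_ M w u) σ b = +-congˡ (≈-sym (u≈ σ b))

  module _ {L : Pred (ℝ^ M) 0ℓ} (isLineality : IsLinealitySpace M L) where
    open IsLinealitySpace isLineality
    open IsSubspace isSubspace

    linearForm∈L : LinearForm ⊆ L
    linearForm∈L = largest LinearForm linearForm-isSubspace linearForm-translates

    -- The zero vector is a valuation, hence so is its translate by `u`.
    L⇒local : ∀ {u} → L u → Local _≤_ (total u)
    L⇒local {u} u∈L = local-resp eq (dressian⇒local (_+ᵛ_ M 0ᵛ u) (translates 0ᵛ u 0∈Dr u∈L))
      where
      0ᵛ : ℝ^ M
      0ᵛ _ _ = 0#
      0∈Dr : Dressian M 0ᵛ
      0∈Dr = local⇒dressian 0ᵛ (local-resp (λ σ b → reflexive (≡.sym (total-basis 0ᵛ σ b))) local-0)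
      eq : ∀ σ → Basis σ → total (_+ᵛ_ M 0ᵛ u) σ ≈ total u σ
      eq σ b rewrite total-basis u σ b | total-basis (_+ᵛ_ M 0ᵛ u) σ b = +-identityˡ _

    L-affine : ∀ {u} → L u → ∃[ k ] ∃[ c ] (∀ σ (b : Basis σ) → u σ b ≈ k + lin c σ)
    L-affine {u} u∈L = restrict (affine (total u) (L⇒local u∈L) local≥)
      where
      restrict : ∃[ k ] ∃[ c ] (∀ σ → Basis σ → total u σ ≈ k + lin c σ) →
                 ∃[ k ] ∃[ c ] (∀ σ (b : Basis σ) → u σ b ≈ k + lin c σ)
      restrict (k , c , eq) = k , c , λ σ b → ≈-trans (reflexive (≡.sym (total-basis u σ b))) (eq σ b)
      neg : ∀ σ → Basis σ → total (_*ᵛ_ M (- 1#) u) σ ≈ - total u σ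
      neg σ b rewrite total-basis (_*ᵛ_ M (- 1#) u) σ b | total-basis u σ b = ℝ-Ring.-1*x≈-x _
      local≥ : Local (flip _≤_) (total u)
      local≥ = local-neg⁻¹ (total u) (local-resp neg (L⇒local (*-closed (- 1#) u∈L)))

  -- Minimal bases and the matroid they form.

  Min : (Subset n → Carrier) → Pred (Subset n) 0ℓ
  Min F σ = Basis σ × (∀ τ → Basis τ → F σ ≤ F τ)

  min-exists : ∀ F → Satisfiable (Min F)
  min-exists F with minimiser (subsets n) Basis? F nonempty
  ... | σ , bσ , min = σ , bσ , λ τ → min τ (∈-subsets τ)

  min? : ∀ F → Decidable (Min F)
  min? F σ with min-exists F | Basis? σ
  ... | _            | no ¬b = no (¬b ∘ proj₁)
  ... | β , bβ , min | yes b with F σ ≤? F β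
  ...   | yes le = yes (b , λ τ bτ → ≤-trans le (min τ bτ))
  ...   | no  ≰  = no (λ (_ , minσ) → ≰ (minσ β bβ))

  -- An exchange between two minimisers does not increase the sum, and neither new basis lies below
  -- the minimum; so the exchanged basis is again a minimiser.
  minimalBases : ∀ F → Local _≤_ F → Matroid n d
  minimalBases F local = record
    { Basis    = Min F
    ; Basis?   = min? F
    ; nonempty = min-exists F
    ; rank     = rank ∘ proj₁
    ; exchange = exch
    }
    where
    exch : ∀ {σ τ} → Min F σ → Min F τ → ∀ {i} → i ∈ σ → i ∉ τ →
           ∃[ j ] j ∈ τ × j ∉ σ × Min F ((σ - i) ∪ ⁅ j ⁆)
    exch {σ} {τ} (bσ , minσ) (bτ , minτ) {i} i∈σ i∉τ
      with valuated-exchange F local σ τ (⊂-wellFounded _) bσ bτ ([]=⇒lookup i∈σ) (∉⇒∌ i∉τ)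
    ... | j , τ∋j , σ∌j , bσ′ , bτ′ , le = j , lookup⇒[]= j τ τ∋j , ∌⇒∉ σ∌j ,
            subst (Min F) (≡.sym (exchange-⟨↦⟩ σ i j)) (bσ′ , λ ρ bρ → ≤-trans Fσ′≤Fσ (minσ ρ bρ))
      where
      Fσ′≤Fσ : F (σ ⟨ i ↦ j ⟩) ≤ F σ
      Fσ′≤Fσ = ≤-by (+-mono-≤ le (minτ (τ ⟨ j ↦ i ⟩) bτ′))
        (solve 4 (λ s t s′ t′ → s′ :+ (s :+ t :+ t′) := s :+ (s′ :+ t′ :+ t)) ≈-refl
          (F σ) (F τ) (F (σ ⟨ i ↦ j ⟩)) (F (τ ⟨ j ↦ i ⟩)))

-- Cells of the regular subdivision as hulls of minimal bases.

module Cells (ℝ : RealField) {n d} (M : Matroid n d) where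
  open RealField ℝ hiding (zero; _-_) renaming (refl to ≈-refl; sym to ≈-sym; trans to ≈-trans)
  open Reals ℝ
  open Convexity ℝ
  open Matroid M
  open ValuatedExchange ℝ M
  open Dressians ℝ M
  open Valuations ℝ
  open SemiringSum semiring using (sum-cong-≋; sum-init-last)

  snoc : ∀ {m} → Vector Carrier m → Carrier → Vector Carrier (ℕ.suc m)
  snoc {ℕ.zero}  xs x _       = x
  snoc {ℕ.suc m} xs x zero    = xs zero
  snoc {ℕ.suc m} xs x (suc i) = snoc (tail xs) x i

  init-snoc : ∀ {m} (xs : Vector Carrier m) x i → init (snoc xs x) i ≡ xs i
  init-snoc xs x zero    = refl
  init-snoc xs x (suc i) = init-snoc (tail xs) x i

  last-snoc : ∀ {m} (xs : Vector Carrier m) x → last (snoc xs x) ≡ x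
  last-snoc {ℕ.zero}  xs x = refl
  last-snoc {ℕ.suc m} xs x = last-snoc (tail xs) x

  Vertex : Pred (Subset n) 0ℓ → Pred (Vector Carrier n) 0ℓ
  Vertex P x = ∃[ σ ] P σ × x ≋ e σ

  Hull : Pred (Subset n) 0ℓ → Pred (Vector Carrier n) 0ℓ
  Hull P = conv (Vertex P)

  hull-mono : ∀ {P Q} → P ⊆ Q → Hull P ⊆ Hull Q
  hull-mono {P} {Q} P⊆Q = conv-mono {A = Vertex P} {B = Vertex Q} (λ (σ , Pσ , x≋) → σ , P⊆Q Pσ , x≋)

  min-scale : ∀ {F G : Subset n → Carrier} a k → 0# ≤ a → (∀ σ → Basis σ → G σ ≈ k + a * F σ) → Min F ⊆ Min G
  min-scale a k 0≤a G≈ (bσ , min) = bσ , λ τ bτ →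
    ≤-respˡ (≈-sym (G≈ _ bσ)) (≤-respʳ (≈-sym (G≈ τ bτ)) (+-monoʳ-≤ k (*-monoˡ-≤ 0≤a (min τ bτ))))

  module _ (v : ℝ^ M) (c : Vector Carrier (ℕ.suc n)) where

    -- The value of the functional `c` at the lifted vertex of `σ`.
    height : Subset n → Carrier
    height σ = lin (init c) σ + last c * total v σ

    private
      Lifted : Pred (Vector Carrier (ℕ.suc n)) 0ℓ
      Lifted y = ∃[ σ ] Σ[ b ∈ Basis σ ] init y ≋ e σ × last y ≈ v σ b

      ⟨⟩≈height : ∀ {y σ} (b : Basis σ) → init y ≋ e σ → last y ≈ v σ b → ⟨ c , y ⟩ ≈ height σ
      ⟨⟩≈height {y} {σ} b init≋ last≈ = ≈-trans (sum-init-last (λ t → c t * y t))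
        (+-cong (⟨⟩-cong (init c) init≋)
          (*-congˡ (≈-trans last≈ (reflexive (≡.sym (total-basis v σ b))))))

      lift : ∀ σ → Basis σ → Vector Carrier (ℕ.suc n)
      lift σ b = snoc (e σ) (v σ b)

      init-lift : ∀ σ b → init (lift σ b) ≋ e σ
      init-lift σ b t = reflexive (init-snoc (e σ) (v σ b) t)

      last-lift : ∀ σ b → last (lift σ b) ≈ v σ b
      last-lift σ b = reflexive (last-snoc (e σ) (v σ b))

      lift∈ : ∀ σ b → Lifted (lift σ b)
      lift∈ σ b = σ , b , init-lift σ b , last-lift σ b

      argmin⇒min : ∀ {y} → ArgMin Lifted c y → ∃[ σ ] Min height σ × init y ≋ e σ
      argmin⇒min {y} ((σ , b , init≋ , last≈) , min) = σ , (b , λ τ bτ →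
        ≤-respˡ (⟨⟩≈height {y} b init≋ last≈)
          (≤-respʳ (⟨⟩≈height {lift τ bτ} bτ (init-lift τ bτ) (last-lift τ bτ)) (min (lift τ bτ) (lift∈ τ bτ)))) ,
        init≋

      min⇒argmin : ∀ {σ} ((b , _) : Min height σ) → ArgMin Lifted c (lift σ b)
      min⇒argmin {σ} (b , min) = lift∈ σ b , λ z (τ , bτ , init≋ , last≈) →
        ≤-respˡ (≈-sym (⟨⟩≈height {lift σ b} b (init-lift σ b) (last-lift σ b)))
          (≤-respʳ (≈-sym (⟨⟩≈height {z} bτ init≋ last≈)) (min τ bτ))

      face≐ : face (liftedPolytope M v) c ≐ conv (ArgMin Lifted c)
      face≐ = face-conv Lifted c (let σ , min = min-exists height in lift σ (proj₁ min) , min⇒argmin min)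

    -- By `face-conv` the face is the hull of the minimal lifted vertices. Projection keeps the
    -- weights, and conversely the vertices of a minimal basis lift with the same weights.
    projected-face : project (face (liftedPolytope M v) c) ≐ Hull (Min height)
    projected-face = to , from
      where
      to : project (face (liftedPolytope M v) c) ⊆ Hull (Min height)
      to (y , y∈face , x≋) with proj₁ face≐ y∈face
      ... | k , p , w , p∈ , w≥0 , Σw≈1 , y≋ =
        k , (λ a → init (p a)) , w , (λ a → argmin⇒min {p a} (p∈ a)) , w≥0 , Σw≈1 , λ t → ≈-trans (x≋ t) (y≋ _)
      from : Hull (Min height) ⊆ project (face (liftedPolytope M v) c)
      from (k , p , w , p∈ , w≥0 , Σw≈1 , x≋) =
        combination w q ,
        proj₂ face≐ (k , q , w , (λ a → min⇒argmin (proj₁ (proj₂ (p∈ a)))) , w≥0 , Σw≈1 , λ _ → ≈-refl) ,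
        λ t → ≈-trans (x≋ t) (sum-cong-≋ (λ a → *-congˡ
          (≈-trans (proj₂ (proj₂ (p∈ a)) t) (≈-sym (init-lift _ (proj₁ (proj₁ (proj₂ (p∈ a)))) t)))))
        where
        q : Fin k → Vector Carrier (ℕ.suc n)
        q a = lift (proj₁ (p∈ a)) (proj₁ (proj₁ (proj₂ (p∈ a))))

    face-satisfiable : Satisfiable (face (liftedPolytope M v) c)
    face-satisfiable with min-exists height
    ... | σ , min = lift σ (proj₁ min) , proj₂ face≐ (∈⇒∈-conv {A = ArgMin Lifted c} (min⇒argmin min))

  initial-basis : ∀ {w N} → IsInitialMatroid M w N → Matroid.Basis N ≐ Min (total w)
  initial-basis {w} {N} initial = to , from
    where
    to : Matroid.Basis N ⊆ Min (total w)
    to {σ} bN with Equivalence.to (initial σ) bN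
    ... | b , min = b , λ τ bτ → ≤-respˡ (reflexive (≡.sym (total-basis w σ b)))
                                   (≤-respʳ (reflexive (≡.sym (total-basis w τ bτ))) (min τ bτ))
    from : Min (total w) ⊆ Matroid.Basis N
    from {σ} (b , min) = Equivalence.from (initial σ)
      (b , λ τ bτ → ≤-respˡ (reflexive (total-basis w σ b)) (≤-respʳ (reflexive (total-basis w τ bτ)) (min τ bτ)))

  minimalBases-initial : ∀ w (local : Local _≤_ (total w)) → IsInitialMatroid M w (minimalBases (total w) local)
  minimalBases-initial w local σ = mk⇔
    (λ (b , min) → b , λ τ bτ → ≤-respˡ (reflexive (total-basis w σ b)) (≤-respʳ (reflexive (total-basis w τ bτ)) (min τ bτ)))
    (λ (b , min) → b , λ τ bτ → ≤-respˡ (reflexive (≡.sym (total-basis w σ b)))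
                                  (≤-respʳ (reflexive (≡.sym (total-basis w τ bτ))) (min τ bτ)))

  inverse-nonNeg : ∀ {x y} → 0# ≤ x → x * y ≈ 1# → 0# ≤ y
  inverse-nonNeg {x} {y} 0≤x xy≈1 with 0# ≤? y
  ... | yes 0≤y = 0≤y
  ... | no  0≰y = contradiction (≤-respˡ xy≈1 (≤-respʳ (zeroʳ x) (*-monoˡ-≤ 0≤x (≰⇒≥ 0≰y)))) 1≰0

  subdivision≐initialPolytopes : ∀ v → Dressian M v → ∀ L → IsLinealitySpace M L →
                                 Subdivision M v ≐ InitialPolytopes M (translate M v L)
  subdivision≐initialPolytopes v v∈Dr L isLineality = to , from
    where
    to : Subdivision M v ⊆ InitialPolytopes M (translate M v L)
    to {C} (c , (0≤γ , 0≉γ) , _ , C≐) =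
      w , (u , u∈L , λ σ b → ≈-refl) , minimalBases (total w) local , minimalBases-initial w local ,
      (λ x∈ → hull-mono (min-scale g 0# 0≤g w≈) (proj₁ (projected-face v c) (proj₁ C≐ x∈))) ,
      (λ x∈ → proj₂ C≐ (proj₂ (projected-face v c) (hull-mono (min-scale γ 0# 0≤γ height≈) x∈)))
      where
      γ : Carrier
      γ = last c
      γ⁻¹ : ∃[ g ] γ * g ≈ 1#
      γ⁻¹ = inverse γ (0≉γ ∘ ≈-sym)
      g : Carrier
      g = proj₁ γ⁻¹
      γg≈1 : γ * g ≈ 1#
      γg≈1 = proj₂ γ⁻¹
      0≤g : 0# ≤ g
      0≤g = inverse-nonNeg 0≤γ γg≈1
      u w : ℝ^ M
      -- Division of the functional by its last coordinate `γ` leaves `v` plus a linear form, and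
      -- linear forms belong to `L`.
      u σ _ = g * lin (init c) σ
      w = _+ᵛ_ M v u
      u∈L : L u
      u∈L = linearForm∈L isLineality ((λ t → g * init c t) , λ σ _ → ≈-sym (lin-* g (init c) σ))
      local : Local _≤_ (total w)
      local = dressian⇒local w (IsLinealitySpace.translates isLineality v u v∈Dr u∈L)
      w≡ : ∀ σ → Basis σ → total w σ ≡ total v σ + g * lin (init c) σ
      w≡ σ b rewrite total-basis w σ b | total-basis v σ b = refl
      cancel : ∀ a b x → a * b ≈ 1# → a * (b * x) ≈ x
      cancel a b x ab≈1 = ≈-trans (≈-sym (*-assoc a b x)) (≈-trans (*-congʳ ab≈1) (*-identityˡ x))
      height≈ : ∀ σ → Basis σ → height v c σ ≈ 0# + γ * total w σ
      height≈ σ b rewrite w≡ σ b = ≈-sym (begin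
        0# + γ * (total v σ + g * l)        ≈⟨ +-identityˡ _ ⟩
        γ * (total v σ + g * l)             ≈⟨ distribˡ γ _ _ ⟩
        γ * total v σ + γ * (g * l)         ≈⟨ +-congˡ (cancel γ g l γg≈1) ⟩
        γ * total v σ + l                   ≈⟨ +-comm _ _ ⟩
        l + γ * total v σ                   ∎)
        where
        open SetoidReasoning setoid
        l = lin (init c) σ
      w≈ : ∀ σ → Basis σ → total w σ ≈ 0# + g * height v c σ
      w≈ σ b rewrite w≡ σ b = ≈-sym (begin
        0# + g * (l + γ * total v σ)        ≈⟨ +-identityˡ _ ⟩
        g * (l + γ * total v σ)             ≈⟨ distribˡ g _ _ ⟩
        g * l + g * (γ * total v σ)         ≈⟨ +-congˡ (cancel g γ (total v σ) (≈-trans (*-comm g γ) γg≈1)) ⟩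
        g * l + total v σ                   ≈⟨ +-comm _ _ ⟩
        total v σ + g * l                   ∎)
        where
        open SetoidReasoning setoid
        l = lin (init c) σ

    from : InitialPolytopes M (translate M v L) ⊆ Subdivision M v
    from {C} (w , (u , u∈L , w≈) , N , initial , C≐) = go (L-affine isLineality u∈L)
      where
      go : ∃[ k ] ∃[ c ] (∀ σ (b : Basis σ) → u σ b ≈ k + lin c σ) → Subdivision M v C
      go (k , c , u≈) =
        ĉ , 0<1 , face-satisfiable v ĉ ,
        (λ x∈ → proj₂ (projected-face v ĉ)
                  (hull-mono (min-scale 1# (- k) 0≤1 height≈ ∘ proj₁ (initial-basis {w} {N} initial)) (proj₁ C≐ x∈))) ,
        (λ x∈ → proj₂ C≐ (hull-mono (proj₂ (initial-basis {w} {N} initial) ∘ min-scale 1# k 0≤1 w≈height)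
                  (proj₁ (projected-face v ĉ) x∈)))
        where
        -- The linear part of `u` with last coordinate `1#`. The constant `k` shifts all bases alike
        -- and leaves the minimisers unchanged.
        ĉ : Vector Carrier (ℕ.suc n)
        ĉ = snoc c 1#
        0<1 : 0# < last ĉ
        0<1 rewrite last-snoc c 1# = 0≤1 , 0≉1
        height-ĉ : ∀ σ → height v ĉ σ ≈ lin c σ + total v σ
        height-ĉ σ rewrite last-snoc c 1# = +-cong
          (sum-cong-≋ (λ t → *-congʳ (reflexive (init-snoc c 1# t)))) (*-identityˡ _)
        w≈height : ∀ σ → Basis σ → total w σ ≈ k + 1# * height v ĉ σ
        w≈height σ b rewrite total-basis w σ b = begin
          w σ b                     ≈⟨ w≈ σ b ⟩
          v σ b + u σ b             ≈⟨ +-congˡ (u≈ σ b) ⟩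
          v σ b + (k + lin c σ)     ≈⟨ +-comm _ _ ⟩
          k + lin c σ + v σ b       ≈⟨ +-assoc _ _ _ ⟩
          k + (lin c σ + v σ b)     ≡⟨ cong (λ x → k + (lin c σ + x)) (≡.sym (total-basis v σ b)) ⟩
          k + (lin c σ + total v σ) ≈⟨ +-congˡ (≈-sym (height-ĉ σ)) ⟩
          k + height v ĉ σ          ≈⟨ +-congˡ (≈-sym (*-identityˡ _)) ⟩
          k + 1# * height v ĉ σ     ∎
          where open SetoidReasoning setoid
        height≈ : ∀ σ → Basis σ → height v ĉ σ ≈ - k + 1# * total w σ
        height≈ σ b = begin
          h                       ≈⟨ ≈-sym (+-identityˡ h) ⟩
          0# + h                  ≈⟨ +-congʳ (≈-sym (-‿inverseˡ k)) ⟩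
          - k + k + h             ≈⟨ +-assoc _ _ _ ⟩
          - k + (k + h)           ≈⟨ +-congˡ (+-congˡ (≈-sym (*-identityˡ h))) ⟩
          - k + (k + 1# * h)      ≈⟨ +-congˡ (≈-sym (w≈height σ b)) ⟩
          - k + total w σ         ≈⟨ +-congˡ (≈-sym (*-identityˡ _)) ⟩
          - k + 1# * total w σ    ∎
          where
          open SetoidReasoning setoid
          h = height v ĉ σ

proposition2p5 : (ℝ : RealField) → let open Valuations ℝ in
    ∀ {n d : ℕ} (M : Matroid n d) (v : ℝ^ M) → Dressian M v →
    (L : Pred (ℝ^ M) 0ℓ) → IsLinealitySpace M L →
    Subdivision M v ≐ InitialPolytopes M (translate M v L)
proposition2p5 ℝ M v v∈Dr L isLineality =
  Cells.subdivision≐initialPolytopes ℝ M v v∈Dr L isLineality
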